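{- The theory $\mathsf{KM}+\mathsf{CC}_{\mathsf{set}}$ is solid. That is, let $(\mathcal{M},\mathcal{A})$, $(\mathcal{N},\mathcal{B})$, and $(\mathcal{M}^{\ast},\mathcal{A}^{\ast})$ be models of $\mathsf{KM}+\mathsf{CC}_{\mathsf{set}}$ such that $$(\mathcal{M},\mathcal{A})\trianglerighteq_{\mathrm{par}}(\mathcal{N},\mathcal{B})\trianglerighteq_{\mathrm{par}}(\mathcal{M}^{\ast},\mathcal{A}^{\ast}),$$ and suppose there is an $(\mathcal{M},\mathcal{A})$-definable isomorphism $\widehat{i_0}:(\mathcal{M},\mathcal{A})\to(\mathcal{M}^{\ast},\mathcal{A}^{\ast})$. Then there is an $(\mathcal{N},\mathcal{B})$-definable isomorphism $\widehat{j}:(\mathcal{N},\mathcal{B})\to(\mathcal{M}^{\ast},\mathcal{A}^{\ast})$.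
   Context: **The theory KM.** $\mathsf{KM}$ (Kelley-Morse theory of classes) is formulated in the two-sorted first order language $\mathcal{L}_{\mathsf{KM}}$ with a sort for sets (lower case variables), a sort for classes (upper case variables), equality on each sort, membership $x\in y$ between sets, and membership $x\in X$ between sets and classes. The two sorts do not overlap. Its axioms are: extensionality for classes; the axioms of $\mathsf{ZF}$ for sets, with replacement stated for class functions (if the class $F$ is a function and $a$ is a set then $\{F(x):x\in a\}$ is a set); and the full comprehension scheme: for every $\mathcal{L}_{\mathsf{KM}}$-formula $\varphi(x)$, possibly with set and class parameters and with quantifiers over classes, there is a class $X$ with $\forall x\,(x\in X\leftrightarrow\varphi(x))$ ($X$ not free in $\varphi$). No form of the axiom of choice is included. Models of $\mathsf{KM}$ are represented as $(\mathcal{M},\mathcal{A})$, where $\mathcal{M}\models\mathsf{ZF}$ has universe $M$ and $\mathcal{A}$ is a collection of subsets of $M$. **The scheme $\mathsf{CC}_{\mathsf{set}}$.** It consists of the universal closures of all formulae $$[\forall x\in s\ \exists X\ \varphi(x,X)]\rightarrow[\exists Y\ \forall x\in s\ \varphi(x,(Y)_x)],$$ where $x,s$ range over sets, $X,Y$ over classes, $\varphi(x,X)$ is an $\mathcal{L}_{\mathsf{KM}}$-formula in which $Y$ does not occur free and which may have set or class parameters, and $(Y)_x=\{y:\langle x,y\rangle\in Y\}$, with $\langle x,y\rangle$ the Kuratowski ordered pair. **Definability and interpretations.** For a structure $\mathcal{S}$, "$\mathcal{S}$-definable" means first order definable in $\mathcal{S}$ with parameters from $\mathcal{S}$. For models $\mathcal{S},\mathcal{T}$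 of $\mathsf{KM}$, $\mathcal{S}\trianglerighteq_{\mathrm{par}}\mathcal{T}$ means that $\mathcal{T}$ is interpreted in $\mathcal{S}$ with parameters: each sort of $\mathcal{T}$ is given as $D/E$, where $D$ is an $\mathcal{S}$-definable set of elements of $\mathcal{S}$ (objects of either sort of $\mathcal{S}$ may occur in $D$, so sorts need not be preserved) and $E$ is an $\mathcal{S}$-definable equivalence relation on $D$ interpreting equality (it need not be the identity), and the membership relations of $\mathcal{T}$ are induced by $\mathcal{S}$-definable, $E$-invariant relations. In a chain $\mathcal{S}\trianglerighteq_{\mathrm{par}}\mathcal{T}\trianglerighteq_{\mathrm{par}}\mathcal{U}$, fix the two interpretations; $\mathcal{U}$ is also regarded as interpreted in $\mathcal{S}$ via their composition, and each structure as interpreted in itself via the identity interpretation. **Definable isomorphisms.** Let $\mathcal{S}$ interpret $\mathcal{T}_0$ and $\mathcal{T}_1$ with domains $\delta_0,\delta_1$ and equivalence relations $E_0,E_1$ (sort by sort). An $\mathcal{S}$-definable isomorphism between $\mathcal{T}_0$ and $\mathcal{T}_1$ is an $\mathcal{S}$-definable relation $R\subseteq\delta_0\times\delta_1$ such that (1) the domain and codomain (set of second coordinates) of $R$ are $\delta_0$ and $\delta_1$, respectively; (2) if $x_0Rx_1$, $y_0E_0x_0$ and $y_1E_1x_1$, then $y_0Ry_1$; (3) $F([x_0]_{E_0})=[x_1]_{E_1}\Leftrightarrow x_0Rx_1$ defines an isomorphism $F$ from $\mathcal{T}_0$ to $\mathcal{T}_1$. **Solidity.** A first order theory $T$ is solid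 if for all models $\mathcal{S},\mathcal{T},\mathcal{S}^{\ast}$ of $T$ with $\mathcal{S}\trianglerighteq_{\mathrm{par}}\mathcal{T}\trianglerighteq_{\mathrm{par}}\mathcal{S}^{\ast}$ such that there is an $\mathcal{S}$-definable isomorphism from $\mathcal{S}$ to $\mathcal{S}^{\ast}$, there is a $\mathcal{T}$-definable isomorphism from $\mathcal{T}$ to $\mathcal{S}^{\ast}$. -}

module Defs where

open import Level using (Level; 0ℓ; suc)
open import Data.Empty.Polymorphic using (⊥)
open import Data.List.Base using (List; []; _∷_; _++_)
open import Data.List.Membership.Propositional using (_∈_)
open import Data.List.Relation.Binary.Subset.Propositional using (_⊆_)
open import Data.List.Relation.Unary.All using (All; []; _∷_; lookup)
open import Data.List.Relation.Unary.All.Properties using (++⁺)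
open import Data.List.Relation.Unary.Any using (here; there)
open import Data.Product.Base using (Σ; Σ-syntax; _×_; _,_)
open import Data.Sum.Base using (_⊎_)
open import Data.Unit.Base using (⊤; tt)
open import Function.Bundles using (Bijection; _⇔_)
open import Relation.Binary.Bundles using (Setoid)
open import Relation.Binary.Core using (Rel)
open import Relation.Binary.PropositionalEquality.Core using (refl)
open import Relation.Binary.Structures using (IsEquivalence)
open import Relation.Unary using (Pred)

------------------------------------------------------------------------
-- Syntax

data Sort : Set where
  set cls : Sort

Ctx : Set
Ctx = List Sort

-- A variable of sort s in context Γ is a (typed de Bruijn) index s ∈ Γ.

pattern v0 = here refl
pattern v1 = there v0
pattern v2 = there v1
pattern v3 = there v2

infix  7 _≐_ _ϵ_
infix  6 ∼_
infixr 5 _∧_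
infixr 4 _∨_
infixr 3 _⇒_
infix  2 _⟺_
infix  1 ∀[_]_ ∃[_]_

data Formula (Γ : Ctx) : Set where
  _≐_         : ∀ {s} → s ∈ Γ → s ∈ Γ → Formula Γ
  _ϵ_         : ∀ {s} → set ∈ Γ → s ∈ Γ → Formula Γ
  false       : Formula Γ
  _∧_ _∨_ _⇒_ : Formula Γ → Formula Γ → Formula Γ
  ∀[_]_ ∃[_]_ : (s : Sort) → Formula (s ∷ Γ) → Formula Γ

∼_ : ∀ {Γ} → Formula Γ → Formula Γ
∼ φ = φ ⇒ false

_⟺_ : ∀ {Γ} → Formula Γ → Formula Γ → Formula Γ
φ ⟺ ψ = (φ ⇒ ψ) ∧ (ψ ⇒ φ)

Sentence : Set
Sentence = Formula []

lift : ∀ {Γ Δ : Ctx} {s} → Γ ⊆ Δ → s ∷ Γ ⊆ s ∷ Δ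
lift r (here p)  = here p
lift r (there x) = there (r x)

rename : ∀ {Γ Δ : Ctx} → Γ ⊆ Δ → Formula Γ → Formula Δ
rename r (x ≐ y)    = r x ≐ r y
rename r (x ϵ y)    = r x ϵ r y
rename r false      = false
rename r (φ ∧ ψ)    = rename r φ ∧ rename r ψ
rename r (φ ∨ ψ)    = rename r φ ∨ rename r ψ
rename r (φ ⇒ ψ)    = rename r φ ⇒ rename r ψ
rename r (∀[ s ] φ) = ∀[ s ] rename (lift r) φ
rename r (∃[ s ] φ) = ∃[ s ] rename (lift r) φ

universalClosure : ∀ {Γ} → Formula Γ → Sentence
universalClosure {[]}    φ = φ
universalClosure {s ∷ Γ} φ = universalClosure (∀[ s ] φ)

Theory : Set₁
Theory = Pred Sentence 0ℓ

------------------------------------------------------------------------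
-- The theories KM and CC_set

-- p = {x, y}
isPair : ∀ {Γ} (p x y : set ∈ Γ) → Formula Γ
isPair p x y = ∀[ set ] (v0 ϵ there p ⟺ v0 ≐ there x ∨ v0 ≐ there y)

-- p = ⟨x, y⟩ = {{x}, {x, y}}
isOrderedPair : ∀ {Γ} (p x y : set ∈ Γ) → Formula Γ
isOrderedPair p x y =
  ∀[ set ] (v0 ϵ there p ⟺
    isPair v0 (there x) (there x) ∨ isPair v0 (there x) (there y))

⟨_,_⟩ϵ_ : ∀ {Γ} (x y : set ∈ Γ) (R : cls ∈ Γ) → Formula Γ
⟨ x , y ⟩ϵ R = ∃[ set ] (isOrderedPair v0 (there x) (there y) ∧ v0 ϵ there R)

-- X = (Y)ₓ = { y : ⟨x, y⟩ ∈ Y }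
isSection : ∀ {Γ} (X Y : cls ∈ Γ) (x : set ∈ Γ) → Formula Γ
isSection X Y x = ∀[ set ] (v0 ϵ there X ⟺ (⟨ there x , v0 ⟩ϵ there Y))

isFunction : ∀ {Γ} (F : cls ∈ Γ) → Formula Γ
isFunction F =
    (∀[ set ] (v0 ϵ there F ⇒
      (∃[ set ] ∃[ set ] isOrderedPair v2 v1 v0)))
  ∧ (∀[ set ] ∀[ set ] ∀[ set ]
      ((⟨ v2 , v1 ⟩ϵ F′) ∧ (⟨ v2 , v0 ⟩ϵ F′) ⇒ v1 ≐ v0))
  where F′ = there (there (there F))

extensionality : Sort → Sentence
extensionality s =
  ∀[ s ] ∀[ s ] ((∀[ set ] (v0 ϵ v2 ⟺ v0 ϵ v1)) ⇒ v1 ≐ v0)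

foundation pairing union powerset infinity separation replacement : Sentence

foundation =
  ∀[ set ] ((∃[ set ] v0 ϵ v1) ⇒
    (∃[ set ] (v0 ϵ v1 ∧ ∼ (∃[ set ] (v0 ϵ v1 ∧ v0 ϵ v2)))))

pairing = ∀[ set ] ∀[ set ] ∃[ set ] isPair v0 v2 v1

union =
  ∀[ set ] ∃[ set ] ∀[ set ] (v0 ϵ v1 ⟺ (∃[ set ] (v0 ϵ v3 ∧ v1 ϵ v0)))

powerset =
  ∀[ set ] ∃[ set ] ∀[ set ] (v0 ϵ v1 ⟺ (∀[ set ] (v0 ϵ v1 ⇒ v0 ϵ v3)))

-- There is a set containing ∅ and closed under x ↦ x ∪ {x}.
infinity =
  ∃[ set ]
    ( (∃[ set ] (v0 ϵ v1 ∧ (∀[ set ] ∼ (v0 ϵ v1))))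
    ∧ (∀[ set ] (v0 ϵ v1 ⇒
        (∃[ set ] (v0 ϵ v2 ∧ (∀[ set ] (v0 ϵ v1 ⟺ v0 ϵ v2 ∨ v0 ≐ v2)))))))

-- A single axiom about classes; class comprehension turns it into the
-- separation scheme for all formulas.
separation =
  ∀[ cls ] ∀[ set ] ∃[ set ] ∀[ set ] (v0 ϵ v1 ⟺ v0 ϵ v2 ∧ v0 ϵ v3)

-- The image of a under F is { y : ∃ x ∈ a. ⟨x, y⟩ ∈ F }; F need not be
-- defined on all of a.
replacement =
  ∀[ cls ] (isFunction v0 ⇒
    (∀[ set ] ∃[ set ] ∀[ set ]
      (v0 ϵ v1 ⟺ (∃[ set ] (v0 ϵ v3 ∧ (⟨ v0 , v1 ⟩ϵ there v3))))))

-- The context Γ holds the parameters.  The renaming makes room for X, so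
-- that X is not free in φ.
comprehension : ∀ {Γ} → Formula (set ∷ Γ) → Sentence
comprehension φ =
  universalClosure (∃[ cls ] ∀[ set ] (v0 ϵ v1 ⟺ rename (lift there) φ))

-- φ has the free variables X, x, s (in this order) and the parameters Γ.
-- φ(x, (Y)ₓ) is expressed as ∃ X. X = (Y)ₓ ∧ φ(x, X), where the renaming
-- makes room for Y, so that Y is not free in φ.
classChoice : ∀ {Γ} → Formula (cls ∷ set ∷ set ∷ Γ) → Sentence
classChoice φ =
  universalClosure
    ( (∀[ set ] (v0 ϵ v1 ⇒ (∃[ cls ] φ)))
    ⇒ (∃[ cls ] ∀[ set ] (v0 ϵ v2 ⇒
        (∃[ cls ] (isSection v0 v2 v1 ∧ rename (lift (lift there)) φ)))))

data KM : Theory where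
  extensionality-ax : ∀ s → KM (extensionality s)
  foundation-ax     : KM foundation
  pairing-ax        : KM pairing
  union-ax          : KM union
  powerset-ax       : KM powerset
  infinity-ax       : KM infinity
  separation-ax     : KM separation
  replacement-ax    : KM replacement
  comprehension-ax  : ∀ {Γ} (φ : Formula (set ∷ Γ)) → KM (comprehension φ)

data CCset : Theory where
  classChoice-ax : ∀ {Γ} (φ : Formula (cls ∷ set ∷ set ∷ Γ)) →
                   CCset (classChoice φ)

------------------------------------------------------------------------
-- Structures and satisfaction

-- Each sort is a setoid, whose equality interprets the equality symbol;
-- this is what makes D/E available as a structure.
record Structure (ℓ : Level) : Set (suc ℓ) where
  field
    universe : Sort → Setoid ℓ ℓ

  Elem : Sort → Set ℓ
  Elem s = Setoid.Carrier (universe s)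

  _≈_ : ∀ {s} → Rel (Elem s) ℓ
  _≈_ {s} = Setoid._≈_ (universe s)

  field
    mem      : ∀ {s} → Elem set → Elem s → Set ℓ
    mem-resp : ∀ {s} {x x′ : Elem set} {y y′ : Elem s} →
               x ≈ x′ → y ≈ y′ → mem x y → mem x′ y′

open Structure using (Elem)

Env : ∀ {ℓ} → Structure ℓ → Ctx → Set ℓ
Env 𝒮 = All (Elem 𝒮)

infix 4 _⊨_[_] _⊨_

_⊨_[_] : ∀ {ℓ Γ} (𝒮 : Structure ℓ) → Formula Γ → Env 𝒮 Γ → Set ℓ
𝒮 ⊨ x ≐ y    [ ρ ] = Structure._≈_ 𝒮 (lookup ρ x) (lookup ρ y)
𝒮 ⊨ x ϵ y    [ ρ ] = Structure.mem 𝒮 (lookup ρ x) (lookup ρ y)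
𝒮 ⊨ false    [ ρ ] = ⊥
𝒮 ⊨ φ ∧ ψ    [ ρ ] = 𝒮 ⊨ φ [ ρ ] × 𝒮 ⊨ ψ [ ρ ]
𝒮 ⊨ φ ∨ ψ    [ ρ ] = 𝒮 ⊨ φ [ ρ ] ⊎ 𝒮 ⊨ ψ [ ρ ]
𝒮 ⊨ φ ⇒ ψ    [ ρ ] = 𝒮 ⊨ φ [ ρ ] → 𝒮 ⊨ ψ [ ρ ]
𝒮 ⊨ ∀[ s ] φ [ ρ ] = (a : Elem 𝒮 s) → 𝒮 ⊨ φ [ a ∷ ρ ]
𝒮 ⊨ ∃[ s ] φ [ ρ ] = Σ[ a ∈ Elem 𝒮 s ] 𝒮 ⊨ φ [ a ∷ ρ ]

_⊨_ : ∀ {ℓ} → Structure ℓ → Theory → Set ℓ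
𝒮 ⊨ T = ∀ φ → T φ → 𝒮 ⊨ φ [ [] ]

-- A relation of type Γ that is definable with parameters.
record Definable {ℓ} (𝒮 : Structure ℓ) (Γ : Ctx) : Set ℓ where
  field
    {Δ}     : Ctx
    formula : Formula (Γ ++ Δ)
    params  : Env 𝒮 Δ

  Holds : Env 𝒮 Γ → Set ℓ
  Holds ρ = 𝒮 ⊨ formula [ ++⁺ ρ params ]

open Definable using (Holds)

------------------------------------------------------------------------
-- Interpretations with parameters

-- The domain of each target sort σ may contain objects of both sorts of
-- 𝒮.  A definable relation between such objects is given by one formula
-- for each choice of the sorts of its arguments.
record Interpretation {ℓ} (𝒮 : Structure ℓ) : Set ℓ where
  field
    domain : (σ s : Sort) → Definable 𝒮 (s ∷ [])

  Dom : Sort → Set ℓ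
  Dom σ = Σ[ s ∈ Sort ] Σ[ x ∈ Elem 𝒮 s ] Holds (domain σ s) (x ∷ [])

  field
    equality   : (σ s t : Sort) → Definable 𝒮 (s ∷ t ∷ [])
    membership : (σ s t : Sort) → Definable 𝒮 (s ∷ t ∷ [])

  Eq : ∀ σ → Rel (Dom σ) ℓ
  Eq σ (s , x , _) (t , y , _) = Holds (equality σ s t) (x ∷ y ∷ [])

  -- Members are sets; σ is the sort of the right-hand argument.
  Mem : ∀ σ → Dom set → Dom σ → Set ℓ
  Mem σ (s , x , _) (t , y , _) = Holds (membership σ s t) (x ∷ y ∷ [])

  field
    Eq-isEquivalence : ∀ σ → IsEquivalence (Eq σ)
    Mem-invariant    : ∀ {σ} {x x′ : Dom set} {y y′ : Dom σ} →
                       Eq set x x′ → Eq σ y y′ → Mem σ x y → Mem σ x′ y′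

-- The interpreted structure, with universes D/E.
⟦_⟧ : ∀ {ℓ} {𝒮 : Structure ℓ} → Interpretation 𝒮 → Structure ℓ
⟦ I ⟧ = record
  { universe = λ σ → record { isEquivalence = Eq-isEquivalence σ }
  ; mem      = λ {σ} → Mem σ
  ; mem-resp = λ {σ} {x} {x′} {y} {y′} →
                 Mem-invariant {σ} {x} {x′} {y} {y′}
  }
  where open Interpretation I

-- 𝒮 ⊵ 𝒯: 𝒯 is obtained from 𝒮 by a composition of interpretations, the
-- empty composition being the identity interpretation.
infix  4 _⊵_
infixl 5 _then_

data _⊵_ {ℓ} (𝒮 : Structure ℓ) : Structure ℓ → Set (suc ℓ) where
  identity : 𝒮 ⊵ 𝒮
  _then_   : ∀ {𝒯} → 𝒮 ⊵ 𝒯 → (J : Interpretation 𝒯) → 𝒮 ⊵ ⟦ J ⟧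

-- Unfolding a composition, an object of sort σ of 𝒯 is represented by an
-- object of 𝒮.  The tag records the sorts of the intermediate objects:
-- since the domains of the two sorts of an intermediate structure may
-- overlap, the object of 𝒮 alone would not identify the object of 𝒯.
-- There are finitely many tags.
Tag : ∀ {ℓ} {𝒮 𝒯 : Structure ℓ} → 𝒮 ⊵ 𝒯 → Sort → Set
Tag identity   σ = ⊤
Tag (p then J) σ = Σ[ s ∈ Sort ] Tag p s

sortOf : ∀ {ℓ} {𝒮 𝒯 : Structure ℓ} (p : 𝒮 ⊵ 𝒯) (σ : Sort) → Tag p σ → Sort
sortOf identity   σ _       = σ
sortOf (p then J) σ (s , t) = sortOf p s t

tag : ∀ {ℓ} {𝒮 𝒯 : Structure ℓ} (p : 𝒮 ⊵ 𝒯) (σ : Sort) → Elem 𝒯 σ → Tag p σ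
tag identity   σ _           = tt
tag (p then J) σ (s , x , _) = s , tag p s x

rep : ∀ {ℓ} {𝒮 𝒯 : Structure ℓ} (p : 𝒮 ⊵ 𝒯) (σ : Sort) (x : Elem 𝒯 σ) →
      Elem 𝒮 (sortOf p σ (tag p σ x))
rep identity   σ x           = x
rep (p then J) σ (s , x , _) = rep p s x

------------------------------------------------------------------------
-- Definable isomorphisms and solidity

record Isomorphism {ℓ} (𝒯₀ 𝒯₁ : Structure ℓ) : Set ℓ where
  private
    module T₀ = Structure 𝒯₀
    module T₁ = Structure 𝒯₁

  field
    bijection : ∀ s → Bijection (T₀.universe s) (T₁.universe s)

  fun : ∀ {s} → T₀.Elem s → T₁.Elem s
  fun {s} = Bijection.to (bijection s)

  field
    fun-mem : ∀ {s} (x : T₀.Elem set) (y : T₀.Elem s) →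
              T₀.mem x y ⇔ T₁.mem (fun x) (fun y)

-- An 𝒮-definable isomorphism between the structures 𝒯₀ and 𝒯₁, both
-- interpreted in 𝒮.  The domains δ₀, δ₁ are the carriers Elem 𝒯₀,
-- Elem 𝒯₁, so R is automatically a subset of δ₀ × δ₁.
record DefinableIsomorphism {ℓ} {𝒮 𝒯₀ 𝒯₁ : Structure ℓ}
                            (p : 𝒮 ⊵ 𝒯₀) (q : 𝒮 ⊵ 𝒯₁) : Set ℓ where
  private
    module T₀ = Structure 𝒯₀
    module T₁ = Structure 𝒯₁

  field
    relation : ∀ σ (t : Tag p σ) (u : Tag q σ) →
               Definable 𝒮 (sortOf p σ t ∷ sortOf q σ u ∷ [])

  R : ∀ σ → T₀.Elem σ → T₁.Elem σ → Set ℓ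
  R σ x y =
    Holds (relation σ (tag p σ x) (tag q σ y)) (rep p σ x ∷ rep q σ y ∷ [])

  field
    total       : ∀ σ (x : T₀.Elem σ) → Σ[ y ∈ T₁.Elem σ ] R σ x y
    onto        : ∀ σ (y : T₁.Elem σ) → Σ[ x ∈ T₀.Elem σ ] R σ x y
    invariant   : ∀ σ {x₀ y₀ : T₀.Elem σ} {x₁ y₁ : T₁.Elem σ} →
                  R σ x₀ x₁ → T₀._≈_ {σ} y₀ x₀ → T₁._≈_ {σ} y₁ x₁ →
                  R σ y₀ y₁
    isomorphism : Isomorphism 𝒯₀ 𝒯₁

  open Isomorphism isomorphism using (fun)

  field
    graph : ∀ σ {x₀ : T₀.Elem σ} {x₁ : T₁.Elem σ} →
            T₁._≈_ {σ} (fun x₀) x₁ ⇔ R σ x₀ x₁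

-- The chain 𝒮 ⊵ 𝒯 ⊵ 𝒮* is given by interpretations I of 𝒯 in 𝒮 and J of
-- 𝒮* in 𝒯.
Solid : (ℓ : Level) → Theory → Set (suc ℓ)
Solid ℓ T =
  (𝒮 : Structure ℓ) (I : Interpretation 𝒮) →
  let 𝒯 = ⟦ I ⟧ in (J : Interpretation 𝒯) →
  let 𝒮* = ⟦ J ⟧ in
  𝒮 ⊨ T → 𝒯 ⊨ T → 𝒮* ⊨ T →
  DefinableIsomorphism {𝒮 = 𝒮} {𝒮} {𝒮*} identity (identity then I then J) →
  DefinableIsomorphism {𝒮 = 𝒯} {𝒯} {𝒮*} identity (identity then J)

{-# OPTIONS --safe #-}

-- Let (N, B) be interpreted in (M, A), and (M*, A*) in (N, B).  By
-- comprehension every (N, B)-definable subset of N is a class in B.  The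
-- isomorphism (M, A) ≅ (M*, A*) and comprehension in (M, A) show likewise
-- that every (N, B)-definable subset of M* is a class in A*.  So ∈-induction
-- on N and on M* is available for (N, B)-definable properties.
--
-- Call x ∈ N and y ∈ M* bisimilar, x ≃ y, if a back-and-forth relation that is
-- coded by classes in B contains (x, y).  By induction ≃ is a partial
-- isomorphism; by CC_set (used to choose representatives for the elements of
-- M*) it contains (x, y) as soon as the elements of x and y match.  A
-- comparison of ranks, for which both the domain and the range of ≃ are
-- downward closed, shows that ≃ is total or onto.
--
-- If both hold, ≃ extends to classes.  Otherwise one of (N, B), (M*, A*) is
-- coded by sets of the other one.  If (N, B) is coded in M*, then each
-- (N, B)-definable collection of objects of (N, B) is coded by a class in A*,
-- that is, by an object of (N, B), which contradicts Cantor's theorem.  If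
-- (M*, A*), hence (M, A), is coded in N, then each (M, A)-definable
-- collection of objects of (M, A) is coded by a class in B, that is, by an
-- object of (M, A), again a contradiction.

module Submission where

open import Level using (Level; Lift; lift; suc)
open import Axiom.ExcludedMiddle using (ExcludedMiddle)
open import Data.Empty.Polymorphic using (⊥; ⊥-elim)
open import Data.List.Base using ([]; _∷_; _++_)
open import Data.List.Membership.Propositional using (_∈_)
open import Data.List.Membership.Propositional.Properties using (∈-++⁺ˡ; ∈-++⁺ʳ)
open import Data.List.Relation.Binary.Subset.Propositional using (_⊆_)
open import Data.List.Relation.Unary.All as All using (All; []; _∷_; lookup)
open import Data.List.Relation.Unary.All.Properties using (++⁺)
open import Data.List.Relation.Unary.Any using (here; there)
open import Data.Product.Base using (Σ; Σ-syntax; _×_; _,_; proj₁; proj₂)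
open import Data.Sum.Base as Sum using (_⊎_; inj₁; inj₂; [_,_]′)
open import Data.Unit.Base using (⊤; tt)
open import Function.Base using (id; _∘_)
open import Function.Bundles using (Bijection; Equivalence; mk⇔)
open import Relation.Binary.Bundles using (Setoid)
open import Relation.Binary.PropositionalEquality.Core
  using (_≡_; refl; sym; trans; cong; cong₂; subst)
open import Relation.Binary.Structures using (IsEquivalence)
open import Relation.Nullary.Decidable.Core using (yes; no)
open import Relation.Unary using (_∪_)
open import Defs renaming (lift to lift⊆)

-- Biconditionals in the form that satisfaction of _⟺_ takes.
infix 0 _⟷_
_⟷_ : ∀ {a b} → Set a → Set b → Set _
P ⟷ Q = (P → Q) × (Q → P)

≡⇒⟷ : ∀ {a} {P Q : Set a} → P ≡ Q → P ⟷ Q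
≡⇒⟷ refl = id , id

module _ {a b} {P : Set a} {Q : Set b} where

  fwd : P ⟷ Q → P → Q
  fwd = proj₁

  bwd : P ⟷ Q → Q → P
  bwd = proj₂

  ⟷-sym : P ⟷ Q → Q ⟷ P
  ⟷-sym (f , g) = g , f

module _ {a b c} {P : Set a} {Q : Set b} {R : Set c} where

  ⟷-trans : P ⟷ Q → Q ⟷ R → P ⟷ R
  ⟷-trans (f , g) (h , k) = h ∘ f , g ∘ k

module _ {a b c d} {P : Set a} {P′ : Set b} {Q : Set c} {Q′ : Set d} where

  ×-cong : P ⟷ P′ → Q ⟷ Q′ → P × Q ⟷ P′ × Q′
  ×-cong (f , g) (h , k) = (λ (p , q) → f p , h q) , (λ (p , q) → g p , k q)

  ⊎-cong : P ⟷ P′ → Q ⟷ Q′ → P ⊎ Q ⟷ P′ ⊎ Q′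
  ⊎-cong (f , g) (h , k) = Sum.map f h , Sum.map g k

  →-cong : P ⟷ P′ → Q ⟷ Q′ → (P → Q) ⟷ (P′ → Q′)
  →-cong (f , g) (h , k) = (λ u → h ∘ u ∘ g) , (λ u → k ∘ u ∘ f)

module _ {a b c} {A : Set a} {P : A → Set b} {Q : A → Set c} where

  Σ-cong : (∀ x → P x ⟷ Q x) → Σ A P ⟷ Σ A Q
  Σ-cong h = (λ (x , p) → x , proj₁ (h x) p) , (λ (x , p) → x , proj₂ (h x) p)

  Π-cong : (∀ x → P x ⟷ Q x) → (∀ x → P x) ⟷ (∀ x → Q x)
  Π-cong h = (λ f x → proj₁ (h x) (f x)) , (λ f x → proj₂ (h x) (f x))

-- Renaming and satisfaction

private variable
  Γ Δ Δ′ : Ctx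
  ℓ : Level

lifts : ∀ Γ → Δ ⊆ Δ′ → Γ ++ Δ ⊆ Γ ++ Δ′
lifts []      r = r
lifts (s ∷ Γ) r = lift⊆ (lifts Γ r)

module _ {a} {A : Sort → Set a} where

  lookup-lifts : {r : Δ ⊆ Δ′} (ρ : All A Γ) {π : All A Δ} {π′ : All A Δ′} →
                 (∀ {s} (x : s ∈ Δ) → lookup π′ (r x) ≡ lookup π x) →
                 ∀ {s} (x : s ∈ Γ ++ Δ) →
                 lookup (++⁺ ρ π′) (lifts Γ r x) ≡ lookup (++⁺ ρ π) x
  lookup-lifts []      h x           = h x
  lookup-lifts (a ∷ ρ) h (here refl) = refl
  lookup-lifts (a ∷ ρ) h (there x)   = lookup-lifts ρ h x

  lookup-++ˡ : (ρ : All A Γ) (π : All A Δ) → ∀ {s} (x : s ∈ Γ) →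
               lookup (++⁺ ρ π) (∈-++⁺ˡ x) ≡ lookup ρ x
  lookup-++ˡ (a ∷ ρ) π (here refl) = refl
  lookup-++ˡ (a ∷ ρ) π (there x)   = lookup-++ˡ ρ π x

  lookup-++ʳ : (ρ : All A Γ) (π : All A Δ) → ∀ {s} (x : s ∈ Δ) →
               lookup (++⁺ ρ π) (∈-++⁺ʳ Γ x) ≡ lookup π x
  lookup-++ʳ []      π x = refl
  lookup-++ʳ (a ∷ ρ) π x = lookup-++ʳ ρ π x

module _ (𝒮 : Structure ℓ) where

  rename-⊨ : (r : Γ ⊆ Δ) (φ : Formula Γ) {ρ : Env 𝒮 Γ} {ρ′ : Env 𝒮 Δ} →
             (∀ {s} (x : s ∈ Γ) → lookup ρ′ (r x) ≡ lookup ρ x) →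
             𝒮 ⊨ rename r φ [ ρ′ ] ⟷ 𝒮 ⊨ φ [ ρ ]
  rename-⊨ r (_≐_ {s} x y) h rewrite h x | h y = id , id
  rename-⊨ r (x ϵ y) h rewrite h x | h y = id , id
  rename-⊨ r false   h = id , id
  rename-⊨ r (φ ∧ ψ) h = ×-cong (rename-⊨ r φ h) (rename-⊨ r ψ h)
  rename-⊨ r (φ ∨ ψ) h = ⊎-cong (rename-⊨ r φ h) (rename-⊨ r ψ h)
  rename-⊨ r (φ ⇒ ψ) h = →-cong (rename-⊨ r φ h) (rename-⊨ r ψ h)
  rename-⊨ r (∀[ s ] φ) h =
    Π-cong λ a → rename-⊨ (lift⊆ r) φ λ { (here refl) → refl ; (there x) → h x }
  rename-⊨ r (∃[ s ] φ) h =
    Σ-cong λ a → rename-⊨ (lift⊆ r) φ λ { (here refl) → refl ; (there x) → h x }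

  universalClosure-elim : (φ : Formula Γ) → 𝒮 ⊨ universalClosure φ [ [] ] →
                          ∀ ρ → 𝒮 ⊨ φ [ ρ ]
  universalClosure-elim {[]}    φ h []      = h
  universalClosure-elim {s ∷ Γ} φ h (a ∷ ρ) =
    universalClosure-elim (∀[ s ] φ) h ρ a

record Correspondence (𝒮 𝒯 : Structure ℓ) : Set (suc ℓ) where
  private
    module S = Structure 𝒮
    module T = Structure 𝒯
  field
    Rel   : ∀ {s} → S.Elem s → T.Elem s → Set ℓ
    total : ∀ {s} (x : S.Elem s) → Σ[ y ∈ T.Elem s ] Rel x y
    onto  : ∀ {s} (y : T.Elem s) → Σ[ x ∈ S.Elem s ] Rel x y
    equal : ∀ {s} {x x′ : S.Elem s} {y y′ : T.Elem s} → Rel x y → Rel x′ y′ →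
            S._≈_ {s} x x′ ⟷ T._≈_ {s} y y′
    memb  : ∀ {s} {x : S.Elem set} {x′ : S.Elem s} {y : T.Elem set} {y′ : T.Elem s} →
            Rel x y → Rel x′ y′ → S.mem {s} x x′ ⟷ T.mem {s} y y′

  RelEnv : Env 𝒮 Γ → Env 𝒯 Γ → Set ℓ
  RelEnv {Γ} ρ ρ′ = ∀ {s} (x : s ∈ Γ) → Rel (lookup ρ x) (lookup ρ′ x)

  extend : {ρ : Env 𝒮 Γ} {ρ′ : Env 𝒯 Γ} → RelEnv ρ ρ′ →
           ∀ {s} {x : S.Elem s} {y : T.Elem s} → Rel x y → RelEnv (x ∷ ρ) (y ∷ ρ′)
  extend h r (here refl) = r
  extend h r (there x)   = h x

  -- For quantifiers, one direction uses `total` and the other `onto`. `Rel` need not be a function,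
  -- so both setoid equality and an isomorphism are instances.
  transfer : (φ : Formula Γ) {ρ : Env 𝒮 Γ} {ρ′ : Env 𝒯 Γ} → RelEnv ρ ρ′ →
             𝒮 ⊨ φ [ ρ ] ⟷ 𝒯 ⊨ φ [ ρ′ ]
  transfer (x ≐ y) h = equal (h x) (h y)
  transfer (x ϵ y) h = memb (h x) (h y)
  transfer false   h = (λ ()) , (λ ())
  transfer (φ ∧ ψ) h = ×-cong (transfer φ h) (transfer ψ h)
  transfer (φ ∨ ψ) h = ⊎-cong (transfer φ h) (transfer ψ h)
  transfer (φ ⇒ ψ) h = →-cong (transfer φ h) (transfer ψ h)
  transfer (∀[ s ] φ) {ρ} {ρ′} h =
    (λ f y → let (x , r) = onto y in proj₁ (transfer φ (extend {ρ = ρ} {ρ′} h r)) (f x)) ,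
    (λ f x → let (y , r) = total x in proj₂ (transfer φ (extend {ρ = ρ} {ρ′} h r)) (f y))
  transfer (∃[ s ] φ) {ρ} {ρ′} h =
    (λ (x , p) → let (y , r) = total x in y , proj₁ (transfer φ (extend {ρ = ρ} {ρ′} h r)) p) ,
    (λ (y , p) → let (x , r) = onto y in x , proj₂ (transfer φ (extend {ρ = ρ} {ρ′} h r)) p)

module Equality (𝒮 : Structure ℓ) where
  open Structure 𝒮 public

  ≈-refl : ∀ {s} {x : Elem s} → x ≈ x
  ≈-refl {s} = Setoid.refl (universe s)

  ≈-sym : ∀ {s} {x y : Elem s} → x ≈ y → y ≈ x
  ≈-sym {s} = Setoid.sym (universe s)

  ≈-trans : ∀ {s} {x y z : Elem s} → x ≈ y → y ≈ z → x ≈ z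
  ≈-trans {s} = Setoid.trans (universe s)

  ≈-correspondence : Correspondence 𝒮 𝒮
  ≈-correspondence = record
    { Rel   = _≈_
    ; total = λ x → x , ≈-refl
    ; onto  = λ x → x , ≈-refl
    ; equal = λ p q → (λ e → ≈-trans (≈-sym p) (≈-trans e q)) ,
                      (λ e → ≈-trans p (≈-trans e (≈-sym q)))
    ; memb  = λ p q → mem-resp p q , mem-resp (≈-sym p) (≈-sym q)
    }

  _≋_ : Env 𝒮 Γ → Env 𝒮 Γ → Set ℓ
  _≋_ {Γ} ρ ρ′ = ∀ {s} (x : s ∈ Γ) → lookup ρ x ≈ lookup ρ′ x

  ≋-refl : {ρ : Env 𝒮 Γ} → ρ ≋ ρ
  ≋-refl x = ≈-refl

  infixr 5 _∷≋_
  _∷≋_ : {ρ ρ′ : Env 𝒮 Γ} → ∀ {s} {x y : Elem s} → x ≈ y → ρ ≋ ρ′ → (x ∷ ρ) ≋ (y ∷ ρ′)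
  (r ∷≋ h) (here refl) = r
  (r ∷≋ h) (there x)   = h x

  ⊨-resp : (φ : Formula Γ) {ρ ρ′ : Env 𝒮 Γ} → ρ ≋ ρ′ → 𝒮 ⊨ φ [ ρ ] → 𝒮 ⊨ φ [ ρ′ ]
  ⊨-resp φ {ρ} {ρ′} h = proj₁ (Correspondence.transfer ≈-correspondence φ {ρ} {ρ′} h)

-- Definability over 𝒮 of relations between objects of several structures
-- interpreted in 𝒮.  As in DefinableIsomorphism, there is one formula for each
-- choice of the tags of the objects.

InDomain : {𝒯 : Structure ℓ} (J : Interpretation 𝒯) (σ s : Sort) →
           Structure.Elem 𝒯 s → Set ℓ
InDomain J σ s x = Definable.Holds (Interpretation.domain J σ s) (x ∷ [])

record Kind (𝒮 : Structure ℓ) : Set (suc ℓ) where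
  constructor _∙_
  field
    {structure} : Structure ℓ
    chain       : 𝒮 ⊵ structure
    sort        : Sort

open Kind

module _ {𝒮 : Structure ℓ} where

  Obj : Kind 𝒮 → Set ℓ
  Obj k = Structure.Elem (structure k) (sort k)

  infixl 5 _▸_

  data Scope : Set (suc ℓ) where
    ε   : Scope
    _▸_ : Scope → Kind 𝒮 → Scope

  Tuple : Scope → Set ℓ
  Tuple ε       = Lift ℓ ⊤
  Tuple (E ▸ k) = Tuple E × Obj k

  Tags : Scope → Set
  Tags ε       = ⊤
  Tags (E ▸ k) = Tags E × Tag (chain k) (sort k)

  sorts : ∀ E → Tags E → Ctx
  sorts ε       _       = []
  sorts (E ▸ k) (t , u) = sortOf (chain k) (sort k) u ∷ sorts E t

  tags : ∀ E → Tuple E → Tags E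
  tags ε       _       = tt
  tags (E ▸ k) (e , x) = tags E e , tag (chain k) (sort k) x

  reps : ∀ E (e : Tuple E) → Env 𝒮 (sorts E (tags E e))
  reps ε       _       = []
  reps (E ▸ k) (e , x) = rep (chain k) (sort k) x ∷ reps E e

  -- `P` is any predicate of Agda, and `holds` certifies that the formulas selected by the tags
  -- define it. The combinators below mirror connectives and quantifiers, so that a `Def` can be
  -- written in the shape of `P`.
  record Def (E : Scope) (P : Tuple E → Set ℓ) : Set ℓ where
    field
      defn  : (t : Tags E) → Definable 𝒮 (sorts E t)
      holds : ∀ e → Definable.Holds (defn (tags E e)) (reps E e) ⟷ P e

  open Def

  private variable
    E E′ : Scope
    k k′ : Kind 𝒮
    P Q : Tuple E → Set ℓ

  ⟷-Def : Def E P → (∀ e → P e ⟷ Q e) → Def E Q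
  ⟷-Def d h = record { defn = defn d ; holds = λ e → ⟷-trans (holds d e) (h e) }

  module _ (_⊙_ : ∀ {Γ} → Formula Γ → Formula Γ → Formula Γ) where

    combine : Definable 𝒮 Γ → Definable 𝒮 Γ → Definable 𝒮 Γ
    combine {Γ} d₁ d₂ = record
      { formula = rename (lifts Γ ∈-++⁺ˡ) (Definable.formula d₁)
                ⊙ rename (lifts Γ (∈-++⁺ʳ (Definable.Δ d₁))) (Definable.formula d₂)
      ; params  = ++⁺ (Definable.params d₁) (Definable.params d₂)
      }

  combineˡ : (d₁ d₂ : Definable 𝒮 Γ) (ρ : Env 𝒮 Γ) →
             𝒮 ⊨ rename (lifts Γ ∈-++⁺ˡ) (Definable.formula d₁)
               [ ++⁺ ρ (++⁺ (Definable.params d₁) (Definable.params d₂)) ]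
             ⟷ Definable.Holds d₁ ρ
  combineˡ {Γ} d₁ d₂ ρ = rename-⊨ 𝒮 (lifts Γ ∈-++⁺ˡ) (Definable.formula d₁)
    (lookup-lifts ρ (lookup-++ˡ (Definable.params d₁) (Definable.params d₂)))

  combineʳ : (d₁ d₂ : Definable 𝒮 Γ) (ρ : Env 𝒮 Γ) →
             𝒮 ⊨ rename (lifts Γ (∈-++⁺ʳ (Definable.Δ d₁))) (Definable.formula d₂)
               [ ++⁺ ρ (++⁺ (Definable.params d₁) (Definable.params d₂)) ]
             ⟷ Definable.Holds d₂ ρ
  combineʳ {Γ} d₁ d₂ ρ = rename-⊨ 𝒮 (lifts Γ (∈-++⁺ʳ _)) (Definable.formula d₂)
    (lookup-lifts ρ (lookup-++ʳ (Definable.params d₁) (Definable.params d₂)))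

  infixr 5 _∧ᵈ_
  infixr 4 _∨ᵈ_
  infixr 3 _⇒ᵈ_
  infix  2 _⟺ᵈ_

  _∧ᵈ_ : Def E P → Def E Q → Def E (λ e → P e × Q e)
  _∧ᵈ_ {E} d₁ d₂ = record
    { defn  = λ t → combine _∧_ (defn d₁ t) (defn d₂ t)
    ; holds = λ e → ×-cong
        (⟷-trans (combineˡ (defn d₁ _) (defn d₂ _) (reps E e)) (holds d₁ e))
        (⟷-trans (combineʳ (defn d₁ _) (defn d₂ _) (reps E e)) (holds d₂ e))
    }

  _∨ᵈ_ : Def E P → Def E Q → Def E (λ e → P e ⊎ Q e)
  _∨ᵈ_ {E} d₁ d₂ = record
    { defn  = λ t → combine _∨_ (defn d₁ t) (defn d₂ t)
    ; holds = λ e → ⊎-cong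
        (⟷-trans (combineˡ (defn d₁ _) (defn d₂ _) (reps E e)) (holds d₁ e))
        (⟷-trans (combineʳ (defn d₁ _) (defn d₂ _) (reps E e)) (holds d₂ e))
    }

  _⇒ᵈ_ : Def E P → Def E Q → Def E (λ e → P e → Q e)
  _⇒ᵈ_ {E} d₁ d₂ = record
    { defn  = λ t → combine _⇒_ (defn d₁ t) (defn d₂ t)
    ; holds = λ e → →-cong
        (⟷-trans (combineˡ (defn d₁ _) (defn d₂ _) (reps E e)) (holds d₁ e))
        (⟷-trans (combineʳ (defn d₁ _) (defn d₂ _) (reps E e)) (holds d₂ e))
    }

  _⟺ᵈ_ : Def E P → Def E Q → Def E (λ e → P e ⟷ Q e)
  d₁ ⟺ᵈ d₂ = (d₁ ⇒ᵈ d₂) ∧ᵈ (d₂ ⇒ᵈ d₁)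

  ⊥ᵈ : Def E (λ _ → ⊥)
  ⊥ᵈ = record
    { defn = λ t → record { formula = false ; params = [] } ; holds = λ e → id , id }

  ∼ᵈ_ : Def E P → Def E (λ e → P e → ⊥)
  ∼ᵈ d = d ⇒ᵈ ⊥ᵈ

  -- Substitution

  data Term : Scope → Kind 𝒮 → Set (suc ℓ) where
    top   : Term (E ▸ k) k
    pop   : Term E k → Term (E ▸ k′) k
    const : Obj k → Term E k

  val : Term E k → Tuple E → Obj k
  val top       (e , x) = x
  val (pop v)   (e , x) = val v e
  val (const c) e       = c

  Ref : Ctx → Sort → Set ℓ
  Ref Γ s = s ∈ Γ ⊎ Structure.Elem 𝒮 s

  deref : Env 𝒮 Γ → ∀ {s} → Ref Γ s → Structure.Elem 𝒮 s
  deref ρ (inj₁ x) = lookup ρ x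
  deref ρ (inj₂ a) = a

  consts : All (Ref Γ) Δ → Ctx
  consts []               = []
  consts (inj₁ _ ∷ α)     = consts α
  consts {Δ = s ∷ _} (inj₂ _ ∷ α) = s ∷ consts α

  constVals : (α : All (Ref Γ) Δ) → Env 𝒮 (consts α)
  constVals []           = []
  constVals (inj₁ _ ∷ α) = constVals α
  constVals (inj₂ a ∷ α) = a ∷ constVals α

  -- A constant becomes a further parameter: the new context lists `Γ`, then the constants of `α`,
  -- then the old parameters `Δ′`.
  substVar : (α : All (Ref Γ) Δ) → Δ ++ Δ′ ⊆ Γ ++ (consts α ++ Δ′)
  substVar {Γ} []           x           = ∈-++⁺ʳ Γ x
  substVar     (inj₁ y ∷ α) (here refl) = ∈-++⁺ˡ y
  substVar     (inj₁ y ∷ α) (there x)   = substVar α x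
  substVar {Γ} (inj₂ a ∷ α) (here refl) = ∈-++⁺ʳ Γ (here refl)
  substVar {Γ} (inj₂ a ∷ α) (there x)   = lifts Γ there (substVar α x)

  lookup-substVar :
    (ρ : Env 𝒮 Γ) (α : All (Ref Γ) Δ) (π : Env 𝒮 Δ′) → ∀ {s} (x : s ∈ Δ ++ Δ′) →
    lookup (++⁺ ρ (++⁺ (constVals α) π)) (substVar α x)
    ≡ lookup (++⁺ (All.map (deref ρ) α) π) x
  lookup-substVar ρ []           π x           = lookup-++ʳ ρ π x
  lookup-substVar ρ (inj₁ y ∷ α) π (here refl) = lookup-++ˡ ρ (++⁺ (constVals α) π) y
  lookup-substVar ρ (inj₁ y ∷ α) π (there x)   = lookup-substVar ρ α π x
  lookup-substVar ρ (inj₂ a ∷ α) π (here refl) =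
    lookup-++ʳ ρ (++⁺ (a ∷ constVals α) π) (here refl)
  lookup-substVar ρ (inj₂ a ∷ α) π (there x)   =
    trans (lookup-lifts ρ (λ _ → refl) (substVar α x)) (lookup-substVar ρ α π x)

  substDefinable : All (Ref Γ) Δ → Definable 𝒮 Δ → Definable 𝒮 Γ
  substDefinable α d = record
    { formula = rename (substVar α) (Definable.formula d)
    ; params  = ++⁺ (constVals α) (Definable.params d)
    }

  substDefinable-holds :
    (α : All (Ref Γ) Δ) (d : Definable 𝒮 Δ) (ρ : Env 𝒮 Γ) →
    Definable.Holds (substDefinable α d) ρ ⟷ Definable.Holds d (All.map (deref ρ) α)
  substDefinable-holds α d ρ =
    rename-⊨ 𝒮 (substVar α) (Definable.formula d)
      (lookup-substVar ρ α (Definable.params d))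

  Located : Kind 𝒮 → Set ℓ
  Located k =
    Σ[ u ∈ Tag (chain k) (sort k) ] Structure.Elem 𝒮 (sortOf (chain k) (sort k) u)

  locate : (x : Obj k) → Located k
  locate {k} x = tag (chain k) (sort k) x , rep (chain k) (sort k) x

  termTag : Term E k → Tags E → Tag (chain k) (sort k)
  termTag top               (t , u) = u
  termTag (pop v)           (t , u) = termTag v t
  termTag {k = k} (const c) t       = tag (chain k) (sort k) c

  weakenRef : ∀ {s s′} → Ref Γ s → Ref (s′ ∷ Γ) s
  weakenRef = Sum.map₁ there

  termRef : (v : Term E k) (t : Tags E) →
            Ref (sorts E t) (sortOf (chain k) (sort k) (termTag v t))
  termRef top               (t , u) = inj₁ (here refl)
  termRef (pop v)           (t , u) = weakenRef (termRef v t)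
  termRef {k = k} (const c) t       = inj₂ (rep (chain k) (sort k) c)

  deref-weakenRef : ∀ {s s′} {a : Structure.Elem 𝒮 s′} {ρ : Env 𝒮 Γ} (r : Ref Γ s) →
                    deref (a ∷ ρ) (weakenRef r) ≡ deref ρ r
  deref-weakenRef (inj₁ x) = refl
  deref-weakenRef (inj₂ a) = refl

  -- An equality of pairs, because the tags agree only propositionally and the type of the
  -- representative depends on the tag.
  locate-val : (v : Term E k) (e : Tuple E) →
               _≡_ {A = Located k}
                   (termTag v (tags E e) , deref (reps E e) (termRef v (tags E e)))
                   (locate {k} (val v e))
  locate-val top       (e , x) = refl
  locate-val {E ▸ _} {k} (pop v) (e , x) =
    trans (cong (termTag v (tags E e) ,_) (deref-weakenRef (termRef v (tags E e))))
          (locate-val v e)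
  locate-val (const c) e       = refl

  data Sub (E : Scope) : Scope → Set (suc ℓ) where
    ∅   : Sub E ε
    _▹_ : Sub E E′ → Term E k → Sub E (E′ ▸ k)

  infixl 5 _▹_

  vals : Sub E E′ → Tuple E → Tuple E′
  vals ∅       e = lift tt
  vals (σ ▹ v) e = vals σ e , val v e

  subTags : Sub E E′ → Tags E → Tags E′
  subTags ∅       t = tt
  subTags (σ ▹ v) t = subTags σ t , termTag v t

  subRefs : (σ : Sub E E′) (t : Tags E) → All (Ref (sorts E t)) (sorts E′ (subTags σ t))
  subRefs ∅       t = []
  subRefs (σ ▹ v) t = termRef v t ∷ subRefs σ t

  private
    extend-≡ : {t t′ : Tags E} {ρ : Env 𝒮 (sorts E t)} {ρ′ : Env 𝒮 (sorts E t′)} →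
               _≡_ {A = Σ (Tags E) (Env 𝒮 ∘ sorts E)} (t , ρ) (t′ , ρ′) →
               {a b : Located k} → a ≡ b →
               _≡_ {A = Σ (Tags (E ▸ k)) (Env 𝒮 ∘ sorts (E ▸ k))}
                   ((t , proj₁ a) , proj₂ a ∷ ρ) ((t′ , proj₁ b) , proj₂ b ∷ ρ′)
    extend-≡ refl refl = refl

  reps-vals : (σ : Sub E E′) (e : Tuple E) →
              _≡_ {A = Σ (Tags E′) (Env 𝒮 ∘ sorts E′)}
                  (subTags σ (tags E e) ,
                   All.map (deref (reps E e)) (subRefs σ (tags E e)))
                  (tags E′ (vals σ e) , reps E′ (vals σ e))
  reps-vals ∅       e = refl
  reps-vals {E} {E′ ▸ k} (σ ▹ v) e = extend-≡ {E′} {k} (reps-vals σ e) (locate-val v e)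

  substᵈ : Def E′ P → (σ : Sub E E′) → Def E (λ e → P (vals σ e))
  substᵈ {E′} {P} {E} d σ = record
    { defn  = λ t → substDefinable (subRefs σ t) (defn d (subTags σ t))
    ; holds = λ e → ⟷-trans
        (substDefinable-holds (subRefs σ (tags E e)) (defn d (subTags σ (tags E e))) (reps E e))
        (subst (λ (t , ρ) → Definable.Holds (defn d t) ρ ⟷ P (vals σ e))
               (sym (reps-vals σ e)) (holds d (vals σ e)))
    }

  -- Quantifiers and formulas of interpreted structures

  private
    quantify : ((s : Sort) → ∀ {Γ} → Formula (s ∷ Γ) → Formula Γ) →
               ∀ {s} → Definable 𝒮 (s ∷ Γ) → Definable 𝒮 Γ
    quantify q {s} d = record { formula = q s (Definable.formula d) ; params = Definable.params d }

  Terms : ∀ {𝒯} → Scope → 𝒮 ⊵ 𝒯 → Ctx → Set (suc ℓ)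
  Terms E p Γ = All (λ s → Term E (p ∙ s)) Γ

  termVals : ∀ {𝒯} {p : 𝒮 ⊵ 𝒯} → Terms E p Γ → Tuple E → Env 𝒯 Γ
  termVals vs e = All.map (λ v → val v e) vs

  weakens : ∀ {𝒯} {p : 𝒮 ⊵ 𝒯} → Terms E p Γ → Terms (E ▸ k) p Γ
  weakens = All.map pop

  termVals-weakens : ∀ {𝒯} {p : 𝒮 ⊵ 𝒯} (vs : Terms E p Γ) (e : Tuple (E ▸ k)) →
                     termVals (weakens {k = k} vs) e ≡ termVals vs (proj₁ e)
  termVals-weakens []       e = refl
  termVals-weakens (v ∷ vs) e = cong (val v (proj₁ e) ∷_) (termVals-weakens vs e)

  lookup-termVals : ∀ {𝒯} {p : 𝒮 ⊵ 𝒯} (vs : Terms E p Γ) (e : Tuple E) {s} (x : s ∈ Γ) →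
                    val (lookup vs x) e ≡ lookup (termVals vs e) x
  lookup-termVals (v ∷ vs) e (here refl) = refl
  lookup-termVals (v ∷ vs) e (there x)   = lookup-termVals vs e x

  termVals-++ : ∀ {𝒯} {p : 𝒮 ⊵ 𝒯} (vs : Terms E p Γ) (π : Env 𝒯 Δ) (e : Tuple E) →
                termVals (++⁺ vs (All.map const π)) e ≡ ++⁺ (termVals vs e) π
  termVals-++ []       []      e = refl
  termVals-++ []       (c ∷ π) e = cong (c ∷_) (termVals-++ [] π e)
  termVals-++ (v ∷ vs) π       e = cong (val v e ∷_) (termVals-++ vs π e)

  private
    module _ {𝒯 : Structure ℓ} where
      Atom : (p : 𝒮 ⊵ 𝒯) (s t : Sort) → (Structure.Elem 𝒯 s → Structure.Elem 𝒯 t → Set ℓ) → Set ℓ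
      Atom p s t A = Def (ε ▸ (p ∙ t) ▸ (p ∙ s)) λ e → A (proj₂ e) (proj₂ (proj₁ e))

  -- Simultaneous recursion on the chain and, within it, on formulas. At `p then J` a quantifier
  -- splits into one for each sort of the structure before `J`, relativised to the domain of `J`;
  -- the domain formula is itself translated along the shorter chain `p`.
  ∃ᵈ : ∀ {𝒯} (p : 𝒮 ⊵ 𝒯) σ {P : Tuple E → Structure.Elem 𝒯 σ → Set ℓ} →
       Def (E ▸ (p ∙ σ)) (λ (e , x) → P e x) →
       Def E (λ e → Σ[ x ∈ Structure.Elem 𝒯 σ ] P e x)
  ∀ᵈ : ∀ {𝒯} (p : 𝒮 ⊵ 𝒯) σ {P : Tuple E → Structure.Elem 𝒯 σ → Set ℓ} →
       Def (E ▸ (p ∙ σ)) (λ (e , x) → P e x) →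
       Def E (λ e → (x : Structure.Elem 𝒯 σ) → P e x)
  private
    eqAtom  : ∀ {𝒯} (p : 𝒮 ⊵ 𝒯) σ → Atom p σ σ (Structure._≈_ 𝒯)
    memAtom : ∀ {𝒯} (p : 𝒮 ⊵ 𝒯) σ → Atom p set σ (Structure.mem 𝒯)
  formulaᵈ : ∀ {𝒯} {p : 𝒮 ⊵ 𝒯} (φ : Formula Γ) (vs : Terms E p Γ) →
             Def E (λ e → 𝒯 ⊨ φ [ termVals vs e ])
  holdsᵈ : ∀ {𝒯} {p : 𝒮 ⊵ 𝒯} (d : Definable 𝒯 Γ) (vs : Terms E p Γ) →
           Def E (λ e → Definable.Holds d (termVals vs e))
  -- Once the tag `s` is fixed, the formula speaks only of the underlying object `x`. The proof `h`
  -- does not enter it, so conjoining the domain formula suffices.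
  untag : ∀ {𝒯} {p : 𝒮 ⊵ 𝒯} {J : Interpretation 𝒯} {σ}
          {P : Tuple (E ▸ ((p then J) ∙ σ)) → Set ℓ} →
          Def (E ▸ ((p then J) ∙ σ)) P → ∀ s →
          Def (E ▸ (p ∙ s)) (λ (e , x) → Σ[ h ∈ InDomain J σ s x ] P (e , (s , x , h)))

  ∃ᵈ identity σ d = record
    { defn  = λ t → quantify (λ s φ → ∃[ s ] φ) (defn d (t , tt))
    ; holds = λ e → Σ-cong λ x → holds d (e , x)
    }
  ∃ᵈ (p then J) σ d = ⟷-Def (∃ᵈ p set (untag d set) ∨ᵈ ∃ᵈ p cls (untag d cls)) λ e →
    (λ { (inj₁ (x , h , r)) → (set , x , h) , r
       ; (inj₂ (x , h , r)) → (cls , x , h) , r }) ,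
    (λ { ((set , x , h) , r) → inj₁ (x , h , r)
       ; ((cls , x , h) , r) → inj₂ (x , h , r) })

  ∀ᵈ identity σ d = record
    { defn  = λ t → quantify (λ s φ → ∀[ s ] φ) (defn d (t , tt))
    ; holds = λ e → Π-cong λ x → holds d (e , x)
    }
  ∀ᵈ {E = E} (p then J) σ {P} d = ⟷-Def (∀ᵈ p set (guarded set) ∧ᵈ ∀ᵈ p cls (guarded cls)) λ e →
    (λ { (f , g) (set , x , h) → f x h ; (f , g) (cls , x , h) → g x h }) ,
    (λ f → (λ x h → f (set , x , h)) , (λ x h → f (cls , x , h)))
    where
    guarded : ∀ s → Def (E ▸ (p ∙ s)) (λ (e , x) → (h : InDomain J σ s x) → P e (s , x , h))
    guarded s = ⟷-Def
      (holdsᵈ (Interpretation.domain J σ s) (top ∷ []) ⇒ᵈ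
       record { defn  = λ { (t , u) → defn d (t , (s , u)) }
              ; holds = λ e → id , id })
      λ (e , x) → (λ f h → proj₁ (holds d (e , (s , x , h))) (f h)) ,
                  (λ f h → proj₂ (holds d (e , (s , x , h))) (f h))

  untag {E = E} {p = p} {J} {σ} d s = ⟷-Def
    (holdsᵈ (Interpretation.domain J σ s) (top ∷ []) ∧ᵈ
     record { defn  = λ { (t , u) → defn d (t , (s , u)) }
            ; holds = λ e → id , id })
    λ (e , x) → (λ (h , r) → h , proj₁ (holds d (e , (s , x , h))) r) ,
                (λ (h , r) → h , proj₂ (holds d (e , (s , x , h))) r)

  eqAtom identity σ = record
    { defn = λ t → record { formula = v0 ≐ v1 ; params = [] } ; holds = λ e → id , id }
  eqAtom (p then J) σ = record
    { defn  = λ { ((_ , (t , w)) , (s , u)) → defn (eq s t) ((tt , w) , u) }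
    ; holds = λ { ((e , (t , y , _)) , (s , x , _)) → holds (eq s t) ((e , y) , x) }
    }
    where
    eq : ∀ s t → Def (ε ▸ (p ∙ t) ▸ (p ∙ s)) _
    eq s t = holdsᵈ (Interpretation.equality J σ s t) (top ∷ pop top ∷ [])

  memAtom identity σ = record
    { defn = λ t → record { formula = v0 ϵ v1 ; params = [] } ; holds = λ e → id , id }
  memAtom (p then J) σ = record
    { defn  = λ { ((_ , (t , w)) , (s , u)) → defn (mm s t) ((tt , w) , u) }
    ; holds = λ { ((e , (t , y , _)) , (s , x , _)) → holds (mm s t) ((e , y) , x) }
    }
    where
    mm : ∀ s t → Def (ε ▸ (p ∙ t) ▸ (p ∙ s)) _
    mm s t = holdsᵈ (Interpretation.membership J σ s t) (top ∷ pop top ∷ [])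

  holdsᵈ {𝒯 = 𝒯} d vs = ⟷-Def
    (formulaᵈ (Definable.formula d) (++⁺ vs (All.map const (Definable.params d))))
    λ e → ≡⇒⟷ (cong (𝒯 ⊨ Definable.formula d [_]) (termVals-++ vs (Definable.params d) e))

  formulaᵈ {𝒯 = 𝒯} {p} (x ≐ y) vs = ⟷-Def
    (substᵈ (eqAtom p _) (∅ ▹ lookup vs y ▹ lookup vs x))
    λ e → ≡⇒⟷ (cong₂ (Structure._≈_ 𝒯) (lookup-termVals vs e x) (lookup-termVals vs e y))
  formulaᵈ {𝒯 = 𝒯} {p} (x ϵ y) vs = ⟷-Def
    (substᵈ (memAtom p _) (∅ ▹ lookup vs y ▹ lookup vs x))
    λ e → ≡⇒⟷ (cong₂ (Structure.mem 𝒯) (lookup-termVals vs e x) (lookup-termVals vs e y))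
  formulaᵈ false   vs = ⊥ᵈ
  formulaᵈ (φ ∧ ψ) vs = formulaᵈ φ vs ∧ᵈ formulaᵈ ψ vs
  formulaᵈ (φ ∨ ψ) vs = formulaᵈ φ vs ∨ᵈ formulaᵈ ψ vs
  formulaᵈ (φ ⇒ ψ) vs = formulaᵈ φ vs ⇒ᵈ formulaᵈ ψ vs
  formulaᵈ {𝒯 = 𝒯} {p} (∀[ s ] φ) vs = ∀ᵈ p s (⟷-Def (formulaᵈ φ (top ∷ weakens vs))
    λ (e , x) → ≡⇒⟷ (cong (λ ρ → 𝒯 ⊨ φ [ x ∷ ρ ]) (termVals-weakens vs (e , x))))
  formulaᵈ {𝒯 = 𝒯} {p} (∃[ s ] φ) vs = ∃ᵈ p s (⟷-Def (formulaᵈ φ (top ∷ weakens vs))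
    λ (e , x) → ≡⇒⟷ (cong (λ ρ → 𝒯 ⊨ φ [ x ∷ ρ ]) (termVals-weakens vs (e , x))))

  memᵈ : ∀ {𝒯} {p : 𝒮 ⊵ 𝒯} {s} (v : Term E (p ∙ set)) (w : Term E (p ∙ s)) →
         Def E (λ e → Structure.mem 𝒯 (val v e) (val w e))
  memᵈ v w = formulaᵈ (v0 ϵ v1) (v ∷ w ∷ [])

  eqᵈ : ∀ {𝒯} {p : 𝒮 ⊵ 𝒯} {s} (v w : Term E (p ∙ s)) →
        Def E (λ e → Structure._≈_ 𝒯 {s} (val v e) (val w e))
  eqᵈ v w = formulaᵈ (v0 ≐ v1) (v ∷ w ∷ [])

-- Classical logic

module Classical (em : ExcludedMiddle ℓ) where

  decide : (P : Set ℓ) → P ⊎ (P → ⊥ {ℓ})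
  decide P with em {P}
  ... | yes p = inj₁ p
  ... | no ¬p = inj₂ λ p → lift (¬p p)

  by-contradiction : {P : Set ℓ} → ((P → ⊥ {ℓ}) → ⊥ {ℓ}) → P
  by-contradiction {P} h with decide P
  ... | inj₁ p  = p
  ... | inj₂ ¬p = ⊥-elim (h ¬p)

  counterexample : {A : Set ℓ} {P : A → Set ℓ} →
                   ((∀ x → P x) → ⊥ {ℓ}) → Σ[ x ∈ A ] (P x → ⊥ {ℓ})
  counterexample h = by-contradiction λ k → h λ x → by-contradiction λ ¬p → k (x , ¬p)

  counterexample-∈ : {A : Set ℓ} {M P : A → Set ℓ} →
                     ((∀ x → M x → P x) → ⊥ {ℓ}) → Σ[ x ∈ A ] (M x × (P x → ⊥ {ℓ}))
  counterexample-∈ h = by-contradiction λ k →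
    h λ x m → by-contradiction λ ¬p → k (x , m , ¬p)

-- Set theory inside a model of KM

module ClassTheory (em : ExcludedMiddle ℓ) (𝒜 : Structure ℓ) (km : 𝒜 ⊨ KM) where

  open Classical em
  open Equality 𝒜

  A K : Set ℓ
  A = Elem set
  K = Elem cls

  infix 5 _∊_
  _∊_ : ∀ {s} → A → Elem s → Set ℓ
  _∊_ = mem

  ⟨_,_⟩∊_ : A → A → K → Set ℓ
  ⟨ x , y ⟩∊ Y = 𝒜 ⊨ ⟨ v0 , v1 ⟩ϵ v2 [ x ∷ y ∷ Y ∷ [] ]

  IsPair IsOrderedPair : A → A → A → Set ℓ
  IsPair p x y        = 𝒜 ⊨ isPair v0 v1 v2 [ p ∷ x ∷ y ∷ [] ]
  IsOrderedPair p x y = 𝒜 ⊨ isOrderedPair v0 v1 v2 [ p ∷ x ∷ y ∷ [] ]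

  ∊-respˡ : ∀ {s} {x y : A} {z : Elem s} → x ≈ y → x ∊ z → y ∊ z
  ∊-respˡ e = mem-resp e ≈-refl

  ∊-respʳ : ∀ {s} {x : A} {y z : Elem s} → y ≈ z → x ∊ y → x ∊ z
  ∊-respʳ e = mem-resp ≈-refl e

  SameMembers : ∀ {s t} → Elem s → Elem t → Set ℓ
  SameMembers X Y = ∀ z → z ∊ X ⟷ z ∊ Y

  ≈⇒same : ∀ {s} {X Y : Elem s} → X ≈ Y → SameMembers X Y
  ≈⇒same e z = ∊-respʳ e , ∊-respʳ (≈-sym e)

  opaque
    extensional : ∀ {s} {X Y : Elem s} → SameMembers X Y → X ≈ Y
    extensional {s} = km _ (extensionality-ax s) _ _

  opaque
    pair : ∀ x y → Σ[ p ∈ A ] IsPair p x y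
    pair = km _ pairing-ax

  opaque
    ⋃ : (a : A) → Σ[ b ∈ A ] (∀ z → z ∊ b ⟷ (Σ[ w ∈ A ] w ∊ a × z ∊ w))
    ⋃ = km _ union-ax

  opaque
    𝒫 : (a : A) → Σ[ b ∈ A ] (∀ z → z ∊ b ⟷ (∀ w → w ∊ z → w ∊ a))
    𝒫 = km _ powerset-ax

  opaque
    separate : (X : K) (a : A) → Σ[ b ∈ A ] (∀ z → z ∊ b ⟷ z ∊ a × z ∊ X)
    separate = km _ separation-ax

  opaque
    comprehend : (φ : Formula (set ∷ Γ)) (ρ : Env 𝒜 Γ) →
                 Σ[ X ∈ K ] (∀ x → x ∊ X ⟷ 𝒜 ⊨ φ [ x ∷ ρ ])
    comprehend {Γ} φ ρ =
      let X , h = universalClosure-elim 𝒜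
                    (∃[ cls ] ∀[ set ] (v0 ϵ v1 ⟺ rename (lift⊆ there) φ))
                    (km _ (comprehension-ax φ)) ρ
      in X , λ x → ⟷-trans (h x)
           (rename-⊨ 𝒜 (lift⊆ there) φ λ { (here refl) → refl ; (there y) → refl })

  -- Kuratowski pairs

  opaque
    orderedPair : ∀ x y → Σ[ p ∈ A ] IsOrderedPair p x y
    orderedPair x y =
      let a , ha = pair x x
          b , hb = pair x y
          p , hp = pair a b
      in p , λ z → ⟷-trans (hp z) (⊎-cong (same-pair z a x x ha) (same-pair z b x y hb))
      where
      same-pair : ∀ z p x y → IsPair p x y → z ≈ p ⟷ IsPair z x y
      same-pair z p x y h =
        (λ e w → ⟷-trans (≈⇒same e w) (h w)) ,
        (λ k → extensional λ w → ⟷-trans (k w) (⟷-sym (h w)))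

  opaque
    orderedPair-resp : ∀ {p p′ x x′ y y′} → p ≈ p′ → x ≈ x′ → y ≈ y′ →
                       IsOrderedPair p x y → IsOrderedPair p′ x′ y′
    orderedPair-resp e f g = ⊨-resp (isOrderedPair v0 v1 v2)
      {ρ = _ ∷ _ ∷ _ ∷ []} {ρ′ = _ ∷ _ ∷ _ ∷ []} (e ∷≋ f ∷≋ g ∷≋ ≋-refl {ρ = []})

  opaque
    -- The member {x} of `p` is {x′} or {x′, y′}, and both contain x′. The member {x, y} gives y ≈
    -- x′ or y ≈ y′; combined with the same argument for y′, this leaves only cases in which y ≈ y′.
    orderedPair-injective : ∀ {p x y x′ y′} → IsOrderedPair p x y → IsOrderedPair p x′ y′ →
                            x ≈ x′ × y ≈ y′
    orderedPair-injective {p} {x} {y} {x′} {y′} h h′ = x≈x′ , y≈y′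
      where
      first : ∀ {x y x′ y′} → IsOrderedPair p x y → IsOrderedPair p x′ y′ → x ≈ x′
      first {x} {y} {x′} h h′ =
        let q , hq = pair x x
        in [ (λ k → [ ≈-sym , ≈-sym ]′ (fwd (hq x′) (bwd (k x′) (inj₁ ≈-refl))))
           , (λ k → [ ≈-sym , ≈-sym ]′ (fwd (hq x′) (bwd (k x′) (inj₁ ≈-refl))))
           ]′ (fwd (h′ q) (bwd (h q) (inj₁ hq)))

      second : ∀ {x y x′ y′} → IsOrderedPair p x y → IsOrderedPair p x′ y′ → y ≈ x′ ⊎ y ≈ y′
      second {x} {y} h h′ =
        let q , hq = pair x y
            y∊q = bwd (hq y) (inj₂ ≈-refl)
        in [ (λ k → inj₁ ([ id , id ]′ (fwd (k y) y∊q))) , (λ k → fwd (k y) y∊q) ]′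
           (fwd (h′ q) (bwd (h q) (inj₂ hq)))

      x≈x′ : x ≈ x′
      x≈x′ = first h h′

      y≈y′ : y ≈ y′
      y≈y′ with second h h′ | second h′ h
      ... | inj₂ e | _      = e
      ... | inj₁ _ | inj₂ e = ≈-sym e
      ... | inj₁ e | inj₁ f = ≈-trans e (≈-trans (≈-sym x≈x′) (≈-sym f))

  opaque
    ⟨,⟩∊-resp : ∀ {x x′ y y′ Y} → x ≈ x′ → y ≈ y′ → ⟨ x , y ⟩∊ Y → ⟨ x′ , y′ ⟩∊ Y
    ⟨,⟩∊-resp e f (p , op , m) = p , orderedPair-resp ≈-refl e f op , m

  opaque
    code : (R : A → A → Set ℓ) (Y : K) →
           (∀ {x x′ y y′} → x ≈ x′ → y ≈ y′ → R x y → R x′ y′) →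
           (∀ z → z ∊ Y ⟷ (Σ[ x ∈ A ] Σ[ y ∈ A ] IsOrderedPair z x y × R x y)) →
           ∀ x y → ⟨ x , y ⟩∊ Y ⟷ R x y
    code R Y resp h x y =
      (λ (z , op , m) → let x′ , y′ , op′ , r = fwd (h z) m
                            e , f = orderedPair-injective op′ op
                        in resp e f r) ,
      (λ r → let p , op = orderedPair x y in p , op , bwd (h p) (x , y , op , r))

  -- The second conjunct is the first half of `isFunction`, which `image` has to supply to
  -- replacement.
  Coded : K → (A → A → Set ℓ) → Set ℓ
  Coded Y R = (∀ x y → ⟨ x , y ⟩∊ Y ⟷ R x y)
            × (∀ z → z ∊ Y → Σ[ x ∈ A ] Σ[ y ∈ A ] IsOrderedPair z x y)

  opaque
    comprehend₂ : (φ : Formula (set ∷ set ∷ Γ)) (ρ : Env 𝒜 Γ) →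
                  Σ[ Y ∈ K ] Coded Y (λ x y → 𝒜 ⊨ φ [ y ∷ x ∷ ρ ])
    comprehend₂ {Γ} φ ρ =
      let Y , h = comprehend (∃[ set ] ∃[ set ] (isOrderedPair v2 v1 v0 ∧ rename r φ)) ρ
          h′ = λ z → ⟷-trans (h z) (Σ-cong λ x → Σ-cong λ y → ×-cong (id , id)
                 (rename-⊨ 𝒜 r φ {ρ = y ∷ x ∷ ρ} {ρ′ = y ∷ x ∷ z ∷ ρ}
                   λ { v0 → refl ; v1 → refl ; (there (there i)) → refl }))
      in Y ,
         code (λ x y → 𝒜 ⊨ φ [ y ∷ x ∷ ρ ]) Y
              (λ {x} {x′} {y} {y′} e f →
                 ⊨-resp φ {y ∷ x ∷ ρ} {y′ ∷ x′ ∷ ρ} (f ∷≋ e ∷≋ ≋-refl {ρ = ρ})) h′ ,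
         λ z m → let x , y , op , _ = fwd (h′ z) m in x , y , op
      where
      r : (set ∷ set ∷ Γ) ⊆ (set ∷ set ∷ set ∷ Γ)
      r = lift⊆ (lift⊆ there)

  opaque
    image : (φ : Formula (set ∷ set ∷ Γ)) (ρ : Env 𝒜 Γ) →
            (∀ x y y′ → 𝒜 ⊨ φ [ y ∷ x ∷ ρ ] → 𝒜 ⊨ φ [ y′ ∷ x ∷ ρ ] → y ≈ y′) →
            (a : A) → Σ[ b ∈ A ] (∀ y → y ∊ b ⟷ (Σ[ x ∈ A ] x ∊ a × 𝒜 ⊨ φ [ y ∷ x ∷ ρ ]))
    image φ ρ functional a =
      let F , coded , pairs = comprehend₂ φ ρ
          b , h = km _ replacement-ax F
                    (pairs , λ x y y′ (p , q) →
                      functional x y y′ (fwd (coded x y) p) (fwd (coded x y′) q)) a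
      in b , λ y → ⟷-trans (h y) (Σ-cong λ x → ×-cong (id , id) (coded x y))

  -- Transitive closures

  -- The pairs ⟨n, ⋃ⁿ{x}⟩ with n ∈ ω form the least class that contains
  -- ⟨0, {x}⟩ and is closed under ⟨n, a⟩ ↦ ⟨n + 1, ⋃ a⟩.

  isEmpty : (n : set ∈ Γ) → Formula Γ
  isEmpty n = ∀[ set ] ∼ (v0 ϵ there n)

  isSuc : (m n : set ∈ Γ) → Formula Γ
  isSuc m n = ∀[ set ] (v0 ϵ there m ⟺ v0 ϵ there n ∨ v0 ≐ there n)

  isUnion : (b a : set ∈ Γ) → Formula Γ
  isUnion b a = ∀[ set ] (v0 ϵ there b ⟺ (∃[ set ] (v0 ϵ there (there a) ∧ v1 ϵ v0)))

  isClosed : (G : cls ∈ Γ) (x : set ∈ Γ) → Formula Γ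
  isClosed G x =
      (∀[ set ] ∀[ set ] (isEmpty v1 ∧ isPair v0 (there (there x)) (there (there x)) ⇒
        (⟨ v1 , v0 ⟩ϵ there (there G))))
    ∧ (∀[ set ] ∀[ set ] ∀[ set ] ∀[ set ]
        ((⟨ v3 , v2 ⟩ϵ there (there (there (there G)))) ∧ isSuc v1 v3 ∧ isUnion v0 v2 ⇒
         (⟨ v1 , v0 ⟩ϵ there (there (there (there G))))))

  isStage : (n a x : set ∈ Γ) → Formula Γ
  isStage n a x = ∀[ cls ] (isClosed v0 (there x) ⇒ (⟨ there n , there a ⟩ϵ v0))

  IsSuc IsUnion : A → A → Set ℓ
  IsSuc m n   = 𝒜 ⊨ isSuc v0 v1 [ m ∷ n ∷ [] ]
  IsUnion b a = 𝒜 ⊨ isUnion v0 v1 [ b ∷ a ∷ [] ]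

  IsEmpty : A → Set ℓ
  IsEmpty n = 𝒜 ⊨ isEmpty v0 [ n ∷ [] ]

  opaque
    -- Otherwise m ∈ n and n ∈ m, and the pair {m, n} violates foundation.
    suc-injective : ∀ k m n → IsSuc k m → IsSuc k n → m ≈ n
    suc-injective k m n hm hn
      with fwd (hn m) (bwd (hm m) (inj₂ ≈-refl))
         | fwd (hm n) (bwd (hn n) (inj₂ ≈-refl))
    ... | inj₂ e | _      = e
    ... | inj₁ _ | inj₂ e = ≈-sym e
    ... | inj₁ p | inj₁ q =
      let d , hd = pair m n
          w , w∊d , minimal = km _ foundation-ax d (m , bwd (hd m) (inj₁ ≈-refl))
      in ⊥-elim ([ (λ e → minimal (n , ∊-respʳ (≈-sym e) q , bwd (hd n) (inj₂ ≈-refl)))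
                 , (λ e → minimal (m , ∊-respʳ (≈-sym e) p , bwd (hd m) (inj₁ ≈-refl)))
                 ]′ (fwd (hd w) w∊d))

  IsTransitive : A → Set ℓ
  IsTransitive t = ∀ u v → v ∊ t → u ∊ v → u ∊ t

  module Stages (x : A) where

    Stage : A → A → Set ℓ
    Stage n a = 𝒜 ⊨ isStage v0 v1 v2 [ n ∷ a ∷ x ∷ [] ]

    opaque
      stage-zero : ∀ n a → IsEmpty n → IsPair a x x → Stage n a
      stage-zero n a e p G (base , step) = base n a (e , p)

    opaque
      stage-suc : ∀ n a m b → Stage n a → IsSuc m n → IsUnion b a → Stage m b
      stage-suc n a m b h s u G (base , step) = step n a m b (h G (base , step) , s , u)

    opaque
      -- By comprehension the property is one of the closed classes over which `isStage` quantifies.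
      -- `φ` may itself quantify over classes, and below it contains `isStage`.
      stage-induction : (φ : Formula (set ∷ set ∷ Γ)) (ρ : Env 𝒜 Γ) →
                        (∀ n a → IsEmpty n → IsPair a x x → 𝒜 ⊨ φ [ a ∷ n ∷ ρ ]) →
                        (∀ n a m b → 𝒜 ⊨ φ [ a ∷ n ∷ ρ ] → IsSuc m n → IsUnion b a →
                          𝒜 ⊨ φ [ b ∷ m ∷ ρ ]) →
                        ∀ n a → Stage n a → 𝒜 ⊨ φ [ a ∷ n ∷ ρ ]
      stage-induction φ ρ base step n a h =
        let G , coded , _ = comprehend₂ φ ρ
        in fwd (coded n a) (h G
             ( (λ n a (e , p) → bwd (coded n a) (base n a e p))
             , (λ n a m b (g , s , u) →
                 bwd (coded m b) (step n a m b (fwd (coded n a) g) s u)) ))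

    Inverted : A → A → Set ℓ
    Inverted n a = (IsEmpty n × IsPair a x x)
                 ⊎ (Σ[ m ∈ A ] Σ[ b ∈ A ] Stage m b × IsSuc n m × IsUnion a b)

    opaque
      -- The induction carries along that the pair is a stage, because the successor case of
      -- `Inverted` asserts this of the preceding pair.
      stage-inversion : ∀ n a → Stage n a → Inverted n a
      stage-inversion n a h = proj₂ (stage-induction
        (isStage v1 v0 v2 ∧ ((isEmpty v1 ∧ isPair v0 v2 v2)
          ∨ (∃[ set ] ∃[ set ] (isStage v1 v0 (there (there v2)) ∧ isSuc v3 v1 ∧ isUnion v2 v0))))
        (x ∷ [])
        (λ n a e p → stage-zero n a e p , inj₁ (e , p))
        (λ n a m b (st , _) s u → stage-suc n a m b st s u , inj₂ (n , a , st , s , u))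
        n a h)

    opaque
      stage-resp : ∀ {n n′ a} → n ≈ n′ → Stage n a → Stage n′ a
      stage-resp {n} {n′} {a} e =
        ⊨-resp (isStage v0 v1 v2) {n ∷ a ∷ x ∷ []} {n′ ∷ a ∷ x ∷ []} (e ∷≋ ≋-refl {ρ = a ∷ x ∷ []})

    opaque
      -- This allows replacement to collect the stages into a set. In the successor case inversion
      -- yields some predecessor, which `suc-injective` identifies with `n`.
      stage-functional : ∀ n a a′ → Stage n a → Stage n a′ → a ≈ a′
      stage-functional n a a′ h h′ = stage-induction
        (∀[ set ] (isStage v2 v0 v3 ⇒ v1 ≐ v0)) (x ∷ [])
        base step n a h a′ h′
        where
        base : ∀ n a → IsEmpty n → IsPair a x x → ∀ a′ → Stage n a′ → a ≈ a′
        base n a e p a′ h′ =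
          [ (λ (_ , p′) → extensional λ z → ⟷-trans (p z) (⟷-sym (p′ z)))
          , (λ (m , _ , _ , s , _) → ⊥-elim (e m (bwd (s m) (inj₂ ≈-refl))))
          ]′ (stage-inversion n a′ h′)

        step : ∀ n a m b → (∀ a′ → Stage n a′ → a ≈ a′) → IsSuc m n → IsUnion b a →
               ∀ b′ → Stage m b′ → b ≈ b′
        step n a m b ih s u b′ h′ =
          [ (λ (e , _) → ⊥-elim (e n (bwd (s n) (inj₂ ≈-refl))))
          , (λ (n′ , a′ , st , s′ , u′) →
              let a≈a′ = ih a′ (stage-resp (suc-injective m n′ n s′ s) st)
              in extensional λ z → ⟷-trans (u z) (⟷-trans
                   (Σ-cong λ w → ×-cong (≈⇒same a≈a′ w) (id , id)) (⟷-sym (u′ z))))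
          ]′ (stage-inversion m b′ h′)

    opaque
      stages : (I : A) → Σ[ Z ∈ A ] (∀ a → a ∊ Z ⟷ (Σ[ n ∈ A ] n ∊ I × Stage n a))
      stages = image (isStage v1 v0 v2) (x ∷ []) stage-functional

    module Closure (I : A) (Z t : A)
      (I-suc : ∀ n → n ∊ I → Σ[ m ∈ A ] m ∊ I × IsSuc m n)
      (hZ : ∀ a → a ∊ Z ⟷ (Σ[ n ∈ A ] n ∊ I × Stage n a))
      (ht : ∀ z → z ∊ t ⟷ (Σ[ w ∈ A ] w ∊ Z × z ∊ w)) where

      opaque
        transitive : IsTransitive t
        transitive u v v∊t u∊v =
          let b , b∊Z , v∊b = fwd (ht v) v∊t
              n , n∊I , st = fwd (hZ b) b∊Z
              m , m∊I , s = I-suc n n∊I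
              c , hc = ⋃ b
          in bwd (ht u) (c , bwd (hZ c) (m , m∊I , stage-suc n b m c st s hc)
                             , bwd (hc u) (v , v∊b , u∊v))

        base : ∀ o → o ∊ I → IsEmpty o → x ∊ t
        base o o∊I o-empty =
          let a , ha = pair x x
          in bwd (ht x) (a , bwd (hZ a) (o , o∊I , stage-zero o a o-empty ha)
                             , bwd (ha x) (inj₁ ≈-refl))

    opaque
      transitiveSet : Σ[ t ∈ A ] IsTransitive t × x ∊ t
      transitiveSet =
        -- `I` may contain more than the natural numbers. The other members have no stage and
        -- contribute nothing to `Z`.
        let I , (o , o∊I , o-empty) , I-suc = km _ infinity-ax
            Z , hZ = stages I
            t , ht = ⋃ Z
        in t , Closure.transitive I Z t I-suc hZ ht , Closure.base I Z t I-suc hZ ht o o∊I o-empty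

  open Stages using (transitiveSet)

  -- Induction on membership

  opaque
    -- Foundation speaks of sets, so the complement of `X` is cut down to a transitive set `t` that
    -- contains `x`. By transitivity, the members of a minimal element of this set remain in `t`,
    -- hence lie in `X`.
    class-induction : (X : K) → ((x : A) → (∀ u → u ∊ x → u ∊ X) → x ∊ X) → ∀ x → x ∊ X
    class-induction X progressive x = by-contradiction λ x∉X →
      let t , transitive , x∊t = transitiveSet x
          Y , hY = comprehend (∼ (v0 ϵ v1)) (X ∷ [])
          b , hb = separate Y t
          m , m∊b , minimal = km _ foundation-ax b (x , bwd (hb x) (x∊t , bwd (hY x) x∉X))
          m∊t , m∊Y = fwd (hb m) m∊b
      in fwd (hY m) m∊Y (progressive m λ u u∊m → by-contradiction λ u∉X →
           minimal (u , u∊m , bwd (hb u) (transitive u m m∊t u∊m , bwd (hY u) u∉X)))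

  opaque
    ∊-induction : (φ : Formula (set ∷ Γ)) (ρ : Env 𝒜 Γ) →
                  (∀ x → (∀ u → u ∊ x → 𝒜 ⊨ φ [ u ∷ ρ ]) → 𝒜 ⊨ φ [ x ∷ ρ ]) →
                  ∀ x → 𝒜 ⊨ φ [ x ∷ ρ ]
    ∊-induction φ ρ progressive x =
      let X , h = comprehend φ ρ
      in fwd (h x) (class-induction X
           (λ x ih → bwd (h x) (progressive x λ u m → fwd (h u) (ih u m))) x)

  -- Comparison of ranks, as the greatest relation ≼ such that x ≼ y implies
  -- that each element of x is ≼ some element of y.

  isSimulation : (R : cls ∈ Γ) → Formula Γ
  isSimulation R = ∀[ set ] ∀[ set ] ((⟨ v1 , v0 ⟩ϵ there (there R)) ⇒
    (∀[ set ] (v0 ϵ v2 ⇒ (∃[ set ] (v0 ϵ v2 ∧ (⟨ v1 , v0 ⟩ϵ there (there (there (there R)))))))))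

  private
    Simulated : A → A → Set ℓ
    Simulated x y = Σ[ R ∈ K ] 𝒜 ⊨ isSimulation v0 [ R ∷ [] ] × ⟨ x , y ⟩∊ R

    opaque
      ranking : Σ[ Y ∈ K ] Coded Y Simulated
      ranking = comprehend₂ (∃[ cls ] (isSimulation v0 ∧ (⟨ v2 , v1 ⟩ϵ v0))) []

  opaque
    ≼-class : K
    ≼-class = proj₁ ranking

  infix 5 _≼_
  _≼_ : A → A → Set ℓ
  x ≼ y = ⟨ x , y ⟩∊ ≼-class

  private
    opaque
      unfolding ≼-class
      ≼-coded : ∀ x y → x ≼ y ⟷ Simulated x y
      ≼-coded = proj₁ (proj₂ ranking)

  opaque
    ≼-unfold : ∀ {x y} → x ≼ y → ∀ u → u ∊ x → Σ[ v ∈ A ] v ∊ y × u ≼ v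
    ≼-unfold {x} {y} h u m =
      let R , sim , r = fwd (≼-coded x y) h
          v , m′ , r′ = sim x y r u m
      in v , m′ , bwd (≼-coded u v) (R , sim , r′)

  opaque
    -- As for any greatest post-fixed point: the pairs that satisfy the hypothesis form a
    -- simulation, because `≼-unfold` puts every pair of ≼ among them.
    ≼-fold : ∀ {x y} → (∀ u → u ∊ x → Σ[ v ∈ A ] v ∊ y × u ≼ v) → x ≼ y
    ≼-fold {x} {y} h =
      let S , coded , _ = comprehend₂ (∀[ set ] (v0 ϵ v2 ⇒
                            (∃[ set ] (v0 ϵ v2 ∧ (⟨ v1 , v0 ⟩ϵ there v3)))))
                            (≼-class ∷ [])
      in bwd (≼-coded x y)
           (S , (λ a b s u m → let v , m′ , l = fwd (coded a b) s u m
                                in v , m′ , bwd (coded u v) (≼-unfold l))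
              , bwd (coded x y) h)

  opaque
    ≼-refl : ∀ x → x ≼ x
    ≼-refl = ∊-induction (⟨ v0 , v0 ⟩ϵ v1) (≼-class ∷ []) λ x ih →
      ≼-fold λ u m → u , m , ih u m

  opaque
    -- If x ≼ y fails, some u ∈ x is ≼ no member of y. The induction hypothesis for u then places
    -- each v ∈ y below a member of u, which means y ≼ u.
    ≼-total : ∀ x y → x ≼ y ⊎ (Σ[ u ∈ A ] u ∊ x × y ≼ u)
    ≼-total = ∊-induction
      (∀[ set ] ((⟨ v1 , v0 ⟩ϵ v2) ∨ (∃[ set ] (v0 ϵ v2 ∧ (⟨ v1 , v0 ⟩ϵ v3)))))
      (≼-class ∷ []) λ x ih y → [ inj₁ ∘ ≼-fold , (λ ¬h → inj₂ (
        let u , u∊x , h = counterexample-∈ ¬h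
        in u , u∊x , ≼-fold λ v v∊y → [ (λ l → ⊥-elim (h (v , v∊y , l))) , id ]′ (ih u u∊x v)))
      ]′ (decide (∀ u → u ∊ x → Σ[ v ∈ A ] v ∊ y × u ≼ v))

  private
    -- For α the rank of `x`, this is the level V_(α+1) of the cumulative hierarchy.
    IsLevel : A → A → Set ℓ
    IsLevel s x = ∀ u → u ∊ s ⟷ u ≼ x

    opaque
      levels : (x : A) → Σ[ Z ∈ A ] (∀ s → s ∊ Z ⟷ (Σ[ v ∈ A ] v ∊ x × IsLevel s v))
      levels = image (∀[ set ] (v0 ϵ v1 ⟺ (⟨ v0 , v2 ⟩ϵ v3))) (≼-class ∷ [])
        λ v s s′ l l′ → extensional λ z → ⟷-trans (l z) (⟷-sym (l′ z))

    opaque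
      below : (x : A) → (∀ v → v ∊ x → Σ[ s ∈ A ] IsLevel s v) →
              Σ[ w ∈ A ] (∀ u → u ∊ w ⟷ (Σ[ v ∈ A ] v ∊ x × u ≼ v))
      below x h =
        let Z , hZ = levels x
            w , hw = ⋃ Z
        in w , λ u →
          (λ m → let s , s∊Z , u∊s = fwd (hw u) m
                     v , v∊x , l = fwd (hZ s) s∊Z
                 in v , v∊x , fwd (l u) u∊s) ,
          (λ (v , v∊x , u≼v) →
            let s , l = h v v∊x
            in bwd (hw u) (s , bwd (hZ s) (v , v∊x , l) , bwd (l u) u≼v))

    opaque
      -- The union of the levels of the members of `x` is V_α, and its power set is V_(α+1).
      level : ∀ x → Σ[ s ∈ A ] IsLevel s x
      level = ∊-induction (∃[ set ] ∀[ set ] (v0 ϵ v1 ⟺ (⟨ v0 , v2 ⟩ϵ v3))) (≼-class ∷ [])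
        λ x ih →
          let w , hw = below x ih
              s , hs = 𝒫 w
          in s , λ u → ⟷-trans (hs u)
               ( (λ f → ≼-fold λ v m → fwd (hw v) (f v m))
               , (λ l v m → bwd (hw v) (≼-unfold l v m)))

  opaque
    -- `X` is included in V_α for α the rank of `b`. This takes the place of replacement for images
    -- of sets of another structure, where the map is not a class of 𝒜.
    bounded : (X : K) (b : A) → (∀ u → u ∊ X → Σ[ v ∈ A ] v ∊ b × u ≼ v) →
              Σ[ a ∈ A ] SameMembers a X
    bounded X b h =
      let w , hw = below b (λ v _ → level v)
          a , ha = separate X w
      in a , λ z → proj₂ ∘ fwd (ha z) , λ m → bwd (ha z) (bwd (hw z) (h z m) , m)

  opaque
    successor : ∀ n → Σ[ m ∈ A ] IsSuc m n
    successor n =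
      let a , ha = pair n n
          p , hp = pair n a
          m , hm = ⋃ p
      in m , λ z →
        (λ z∊m → let w , w∊p , z∊w = fwd (hm z) z∊m in
          [ (λ e → inj₁ (∊-respʳ e z∊w))
          , (λ e → inj₂ ([ id , id ]′ (fwd (ha z) (∊-respʳ e z∊w)))) ]′ (fwd (hp w) w∊p)) ,
        [ (λ z∊n → bwd (hm z) (n , bwd (hp n) (inj₁ ≈-refl) , z∊n))
        , (λ e → bwd (hm z) (a , bwd (hp a) (inj₂ ≈-refl) , bwd (ha z) (inj₁ e))) ]′

open Structure using (Elem)

pattern t₀ = top
pattern t₁ = pop t₀
pattern t₂ = pop t₁
pattern t₃ = pop t₂

-- Bisimulations

-- The property has to be definable over the base 𝒯, so it may mention other structures interpreted
-- there. This turns `class-induction` in 𝒜 into induction for such properties.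
Full : {𝒯 𝒜 : Structure ℓ} → 𝒯 ⊵ 𝒜 → Set (suc ℓ)
Full {ℓ} {𝒜 = 𝒜} p = {P : A.Elem set → Set ℓ} → Def (ε ▸ (p ∙ set)) (λ e → P (proj₂ e)) →
  (∀ {x y} → A._≈_ {set} x y → P x → P y) →
  Σ[ X ∈ A.Elem cls ] (∀ x → A.mem {cls} x X ⟷ P x)
  where module A = Structure 𝒜

record Bisimulation {𝒯 𝒜 ℬ : Structure ℓ} (p : 𝒯 ⊵ 𝒜) (q : 𝒯 ⊵ ℬ) : Set (suc ℓ) where
  private
    module A = Structure 𝒜
    module B = Structure ℬ
  infix 4 _~_
  field
    _~_    : A.Elem set → B.Elem set → Set ℓ
    ~-def  : ∀ {E} (v : Term E (p ∙ set)) (w : Term E (q ∙ set)) → Def E (λ e → val v e ~ val w e)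
    ~-resp : ∀ {x x′ y y′} → A._≈_ {set} x x′ → B._≈_ {set} y y′ → x ~ y → x′ ~ y′
    forth  : ∀ {x y} → x ~ y → ∀ u → A.mem u x → Σ[ z ∈ B.Elem set ] B.mem z y × u ~ z
    back   : ∀ {x y} → x ~ y → ∀ z → B.mem z y → Σ[ u ∈ A.Elem set ] A.mem u x × u ~ z

  Matching : A.Elem set → B.Elem set → Set ℓ
  Matching x y = (∀ u → A.mem u x → Σ[ z ∈ B.Elem set ] B.mem z y × u ~ z)
               × (∀ z → B.mem z y → Σ[ u ∈ A.Elem set ] A.mem u x × u ~ z)

  Maximal : Set ℓ
  Maximal = ∀ {x y} → Matching x y → x ~ y

converse : {𝒯 𝒜 ℬ : Structure ℓ} {p : 𝒯 ⊵ 𝒜} {q : 𝒯 ⊵ ℬ} → Bisimulation p q → Bisimulation q p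
converse b = record
  { _~_    = λ y x → x ~ y
  ; ~-def  = λ v w → ~-def w v
  ; ~-resp = λ e f → ~-resp f e
  ; forth  = back
  ; back   = forth
  } where open Bisimulation b

-- Functionality, monotonicity and downward closure of bisimulations

module BisimulationProperties
  (em : ExcludedMiddle ℓ) {𝒯 𝒜 ℬ : Structure ℓ} {p : 𝒯 ⊵ 𝒜} {q : 𝒯 ⊵ ℬ}
  (kmA : 𝒜 ⊨ KM) (kmB : ℬ ⊨ KM) (fullA : Full p)
  (b : Bisimulation p q) where

  open Bisimulation b
  private
    module A where
      open ClassTheory em 𝒜 kmA public
      open Equality 𝒜 public
    module B where
      open ClassTheory em ℬ kmB public
      open Equality ℬ public
    open A using (_∊_)

  Functional : A.A → Set ℓ
  Functional x = ∀ y y′ → x ~ y → x ~ y′ → B._≈_ {set} y y′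

  opaque
    -- By induction on `x`: a member of `y` is carried back to a member of `x` and forth to a member
    -- of `y′`, and the two are equal by the induction hypothesis.
    functional : ∀ {x y y′} → x ~ y → x ~ y′ → B._≈_ {set} y y′
    functional {x} {y} {y′} = fwd (hX x) (A.class-induction X progressive x) y y′
      where
      class : Σ[ X ∈ A.K ] (∀ x → x ∊ X ⟷ Functional x)
      class = fullA
        (∀ᵈ q set (∀ᵈ q set (~-def t₂ t₁ ⇒ᵈ ~-def t₂ t₀ ⇒ᵈ eqᵈ t₁ t₀)))
        (λ e h y y′ r r′ → h y y′ (~-resp (A.≈-sym e) B.≈-refl r) (~-resp (A.≈-sym e) B.≈-refl r′))

      X : A.K
      X = proj₁ class

      hX : ∀ x → x ∊ X ⟷ Functional x
      hX = proj₂ class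

      included : ∀ x → (∀ u → u ∊ x → u ∊ X) → ∀ y y′ → x ~ y → x ~ y′ →
                 ∀ z → z B.∊ y → z B.∊ y′
      included x ih y y′ r r′ z z∊y =
        let u , u∊x , s = back r z z∊y
            z′ , z′∊y′ , s′ = forth r′ u u∊x
        in B.∊-respˡ (B.≈-sym (fwd (hX u) (ih u u∊x) z z′ s s′)) z′∊y′

      progressive : ∀ x → (∀ u → u ∊ x → u ∊ X) → x ∊ X
      progressive x ih = bwd (hX x) λ y y′ r r′ → B.extensional λ z →
        included x ih y y′ r r′ z , included x ih y′ y r′ r z

  Monotone : A.A → Set ℓ
  Monotone u = ∀ v u′ v′ → u ~ u′ → v ~ v′ → u A.≼ v → u′ B.≼ v′

  opaque
    -- By induction on `u`: go back from `u′` to `u`, up to a member of `v`, and forth to `v′`. This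
    -- supplies the rank bounds under which partners form a set.
    monotone : ∀ {u v u′ v′} → u ~ u′ → v ~ v′ → u A.≼ v → u′ B.≼ v′
    monotone {u} {v} {u′} {v′} = fwd (hX u) (A.class-induction X progressive u) v u′ v′
      where
      class : Σ[ X ∈ A.K ] (∀ x → x ∊ X ⟷ Monotone x)
      class = fullA
        (∀ᵈ p set (∀ᵈ q set (∀ᵈ q set (~-def t₃ t₁ ⇒ᵈ ~-def t₂ t₀
          ⇒ᵈ formulaᵈ (⟨ v0 , v1 ⟩ϵ v2) (t₃ ∷ t₂ ∷ const A.≼-class ∷ [])
          ⇒ᵈ formulaᵈ (⟨ v0 , v1 ⟩ϵ v2) (t₁ ∷ t₀ ∷ const B.≼-class ∷ [])))))
        (λ e h v u′ v′ r s l → h v u′ v′ (~-resp (A.≈-sym e) B.≈-refl r) s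
                                 (A.⟨,⟩∊-resp (A.≈-sym e) A.≈-refl l))

      X : A.K
      X = proj₁ class

      hX : ∀ x → x ∊ X ⟷ Monotone x
      hX = proj₂ class

      progressive : ∀ u → (∀ w → w ∊ u → w ∊ X) → u ∊ X
      progressive u ih = bwd (hX u) λ v u′ v′ r s l → B.≼-fold λ z z∊u′ →
        let a , a∊u , t = back r z z∊u′
            c , c∊v , l′ = A.≼-unfold l a a∊u
            w , w∊v′ , t′ = forth s c c∊v
        in w , w∊v′ , fwd (hX a) (ih a a∊u) c z w t t′ l′

  module _ (fullB : Full q) (maximal : Maximal) where

    opaque
      -- The partners of the members of `x` form a class by fullness and a set by the rank bound
      -- `c`. This set matches `x`, so maximality applies.
      inDomain : (x : A.A) (c : B.A) →
                 (∀ u → u ∊ x → Σ[ z ∈ B.A ] u ~ z × (Σ[ v ∈ B.A ] v B.∊ c × z B.≼ v)) →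
                 Σ[ y ∈ B.A ] x ~ y
      inDomain x c h = y , maximal
        ( (λ u u∊x → let z , r , _ = h u u∊x in z , bwd (hY z) (bwd (hW z) (u , u∊x , r)) , r)
        , (λ z z∊y → fwd (hW z) (fwd (hY z) z∊y)) )
        where
        class : Σ[ W ∈ B.K ] (∀ z → z B.∊ W ⟷ (Σ[ u ∈ A.A ] u ∊ x × u ~ z))
        class = fullB (∃ᵈ p set (memᵈ t₀ (const x) ∧ᵈ ~-def t₀ t₁))
                      (λ e (u , m , r) → u , m , ~-resp A.≈-refl e r)

        W : B.K
        W = proj₁ class

        hW : ∀ z → z B.∊ W ⟷ (Σ[ u ∈ A.A ] u ∊ x × u ~ z)
        hW = proj₂ class

        set-W : Σ[ y ∈ B.A ] B.SameMembers y W
        set-W = B.bounded W c λ z z∊W →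
          let u , u∊x , r = fwd (hW z) z∊W
              z′ , r′ , v , v∊c , l = h u u∊x
          -- The bound concerns the partner `z′` provided by `h`; functionality carries it over to
          -- `z`.
          in v , v∊c , B.⟨,⟩∊-resp (functional r′ r) B.≈-refl l

        y : B.A
        y = proj₁ set-W

        hY : B.SameMembers y W
        hY = proj₂ set-W

    Below : A.A → Set ℓ
    Below u = ∀ v v′ → v ~ v′ → u A.≼ v → Σ[ y ∈ B.A ] u ~ y

    opaque
      -- By induction on `u`: members of `u` lie below members of `v` and so have partners, whose
      -- ranks are by `monotone` below members of `v′`. Hence `v′` is a bound for `inDomain`.
      downward : ∀ {u v v′} → v ~ v′ → u A.≼ v → Σ[ y ∈ B.A ] u ~ y
      downward {u} {v} {v′} = fwd (hX u) (A.class-induction X progressive u) v v′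
        where
        class : Σ[ X ∈ A.K ] (∀ u → u ∊ X ⟷ Below u)
        class = fullA
          (∀ᵈ p set (∀ᵈ q set (~-def t₁ t₀
            ⇒ᵈ formulaᵈ (⟨ v0 , v1 ⟩ϵ v2) (t₂ ∷ t₁ ∷ const A.≼-class ∷ [])
            ⇒ᵈ ∃ᵈ q set (~-def t₃ t₀))))
          (λ e h v v′ r l →
            let y , s = h v v′ r (A.⟨,⟩∊-resp (A.≈-sym e) A.≈-refl l)
            in y , ~-resp e B.≈-refl s)

        X : A.K
        X = proj₁ class

        hX : ∀ u → u ∊ X ⟷ Below u
        hX = proj₂ class

        progressive : ∀ u → (∀ w → w ∊ u → w ∊ X) → u ∊ X
        progressive u ih = bwd (hX u) λ v v′ r l → inDomain u v′ λ w w∊u →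
          let c , c∊v , l′ = A.≼-unfold l w w∊u
              d , d∊v′ , s = forth r c c∊v
              z , t = fwd (hX w) (ih w w∊u) c d s l′
          in z , t , d , d∊v′ , monotone t s l′

-- Comparison of two models along a maximal bisimulation

module Comparison
  (em : ExcludedMiddle ℓ) {𝒯 𝒜 ℬ : Structure ℓ} {p : 𝒯 ⊵ 𝒜} {q : 𝒯 ⊵ ℬ}
  (kmA : 𝒜 ⊨ KM) (kmB : ℬ ⊨ KM) (fullA : Full p) (fullB : Full q)
  (b : Bisimulation p q) (maximal : Bisimulation.Maximal b) where

  open Bisimulation b
  open Classical em
  private
    module A where
      open ClassTheory em 𝒜 kmA public
      open Equality 𝒜 public
    module B where
      open ClassTheory em ℬ kmB public
      open Equality ℬ public
    module Forth = BisimulationProperties em kmA kmB fullA b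
    module Back = BisimulationProperties em kmB kmA fullB (converse b)
    open A using (_∊_)

    converse-maximal : Bisimulation.Maximal (converse b)
    converse-maximal (f , g) = maximal (g , f)

  functional : ∀ {x y y′} → x ~ y → x ~ y′ → B._≈_ {set} y y′
  functional = Forth.functional

  injective : ∀ {x x′ y} → x ~ y → x′ ~ y → A._≈_ {set} x x′
  injective = Back.functional

  Total Onto : Set ℓ
  Total = ∀ x → Σ[ y ∈ B.A ] x ~ y
  Onto  = ∀ y → Σ[ x ∈ A.A ] x ~ y

  opaque
    -- The alternative in `≼-total` is y₀ ≼ y, which would put `y₀` into the range by downward
    -- closure for the converse.
    bounded-range : ∀ {x y} y₀ → (∀ x → x ~ y₀ → ⊥ {ℓ}) → x ~ y → Σ[ v ∈ B.A ] v B.∊ y₀ × y B.≼ v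
    bounded-range {x} {y} y₀ ∉ran r =
      [ (λ l → let x₀ , r₀ = Back.downward fullA converse-maximal r l in ⊥-elim (∉ran x₀ r₀))
      , id ]′
      (B.≼-total y₀ y)

    bounded-domain : ∀ {x y} x₀ → (∀ y → x₀ ~ y → ⊥ {ℓ}) → x ~ y → Σ[ v ∈ A.A ] v ∊ x₀ × x A.≼ v
    bounded-domain {x} {y} x₀ ∉dom r =
      [ (λ l → let y₀ , r₀ = Forth.downward fullB maximal r l in ⊥-elim (∉dom y₀ r₀)) , id ]′
      (A.≼-total x₀ x)

  opaque
    -- By induction on `y`. A set `x₀` outside the domain bounds the ranks of the whole domain, so
    -- the preimages of the members of `y` form a set.
    onto-if-not-total : ∀ x₀ → (∀ y → x₀ ~ y → ⊥ {ℓ}) → Onto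
    onto-if-not-total x₀ ∉dom y = fwd (hY y) (B.class-induction Y progressive y)
      where
      class : Σ[ Y ∈ B.K ] (∀ y → y B.∊ Y ⟷ (Σ[ x ∈ A.A ] x ~ y))
      class = fullB (∃ᵈ p set (~-def t₀ t₁)) (λ e (x , r) → x , ~-resp A.≈-refl e r)

      Y : B.K
      Y = proj₁ class

      hY : ∀ y → y B.∊ Y ⟷ (Σ[ x ∈ A.A ] x ~ y)
      hY = proj₂ class

      progressive : ∀ y → (∀ z → z B.∊ y → z B.∊ Y) → y B.∊ Y
      progressive y ih = bwd (hY y) (Back.inDomain fullA converse-maximal y x₀ λ z z∊y →
        let x , r = fwd (hY z) (ih z z∊y)
        in x , r , bounded-domain x₀ ∉dom r)

  -- Extension of a total and onto bisimulation to classes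

  module Totality (total : Total) (onto : Onto) where

    Partners : ∀ σ → A.Elem σ → B.Elem σ → Set ℓ
    Partners set x y = x ~ y
    Partners cls X Y = ∀ x y → x ~ y → x ∊ X ⟷ y B.∊ Y

    Partners-def : ∀ σ {E} (v : Term E (p ∙ σ)) (w : Term E (q ∙ σ)) →
                   Def E (λ e → Partners σ (val v e) (val w e))
    Partners-def set v w = ~-def v w
    Partners-def cls v w = ∀ᵈ p set (∀ᵈ q set (~-def t₁ t₀ ⇒ᵈ
      (memᵈ t₁ (pop (pop v)) ⟺ᵈ memᵈ t₀ (pop (pop w)))))

    Partners-resp : ∀ σ {x x′ y y′} → A._≈_ {σ} x x′ → B._≈_ {σ} y y′ →
                    Partners σ x y → Partners σ x′ y′
    Partners-resp set e f r = ~-resp e f r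
    Partners-resp cls e f h x y r =
      ⟷-trans (⟷-sym (A.≈⇒same e x)) (⟷-trans (h x y r) (B.≈⇒same f y))

    Partners-functional : ∀ σ {x y y′} → Partners σ x y → Partners σ x y′ → B._≈_ {σ} y y′
    Partners-functional set r r′ = functional r r′
    Partners-functional cls h h′ = B.extensional λ y →
      let x , r = onto y in ⟷-trans (⟷-sym (h x y r)) (h′ x y r)

    Partners-injective : ∀ σ {x x′ y} → Partners σ x y → Partners σ x′ y → A._≈_ {σ} x x′
    Partners-injective set r r′ = injective r r′
    Partners-injective cls h h′ = A.extensional λ x →
      let y , r = total x in ⟷-trans (h x y r) (⟷-sym (h′ x y r))

    opaque
      Partners-total : ∀ σ x → Σ[ y ∈ B.Elem σ ] Partners σ x y
      Partners-total set x = total x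
      Partners-total cls X =
        let Y , hY = fullB (∃ᵈ p set (memᵈ t₀ (const X) ∧ᵈ ~-def t₀ t₁))
                           (λ e (x , m , r) → x , m , ~-resp A.≈-refl e r)
        in Y , λ x y r → (λ m → bwd (hY y) (x , m , r)) ,
             (λ m → let x′ , m′ , r′ = fwd (hY y) m in A.∊-respˡ (injective r′ r) m′)

      Partners-onto : ∀ σ y → Σ[ x ∈ A.Elem σ ] Partners σ x y
      Partners-onto set y = onto y
      Partners-onto cls Y =
        let X , hX = fullA (∃ᵈ q set (memᵈ t₀ (const Y) ∧ᵈ ~-def t₁ t₀))
                           (λ e (y , m , r) → y , m , ~-resp e B.≈-refl r)
        in X , λ x y r →
             (λ m → let y′ , m′ , r′ = fwd (hX x) m in B.∊-respˡ (functional r′ r) m′) ,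
             (λ m → bwd (hX x) (y , m , r))

    Partners-mem : ∀ σ {x x′ y y′} → x ~ x′ → Partners σ y y′ → A.mem {σ} x y ⟷ B.mem {σ} x′ y′
    Partners-mem set r s =
      (λ m → let z , n , t = forth s _ m in B.∊-respˡ (functional t r) n) ,
      (λ m → let z , n , t = back s _ m in A.∊-respˡ (injective t r) n)
    Partners-mem cls r h = h _ _ r

    definableIsomorphism : DefinableIsomorphism p q
    definableIsomorphism = record
      { relation    = λ σ t u → Def.defn (partners σ) ((tt , u) , t)
      ; total       = λ σ x → let y , r = Partners-total σ x in y , bwd (defines σ x y) r
      ; onto        = λ σ y → let x , r = Partners-onto σ y in x , bwd (defines σ x y) r
      ; invariant   = λ σ {x} {x′} {y} {y′} r e f → bwd (defines σ x′ y′)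
          (Partners-resp σ (A.≈-sym e) (B.≈-sym f) (fwd (defines σ x y) r))
      ; isomorphism = record
        { bijection = λ σ → record
          { to        = λ x → proj₁ (Partners-total σ x)
          ; cong      = λ {x} {x′} e → Partners-functional σ
              (proj₂ (Partners-total σ x))
              (Partners-resp σ (A.≈-sym e) B.≈-refl (proj₂ (Partners-total σ x′)))
          ; bijective =
              (λ {x} {x′} e → Partners-injective σ
                (Partners-resp σ A.≈-refl e (proj₂ (Partners-total σ x)))
                (proj₂ (Partners-total σ x′))) ,
              (λ y → let x , r = Partners-onto σ y in x , λ {z} e → Partners-functional σ
                (proj₂ (Partners-total σ z)) (Partners-resp σ (A.≈-sym e) B.≈-refl r))
          }
        ; fun-mem = λ {σ} x y → let f , g = Partners-mem σ
                                      (proj₂ (Partners-total set x)) (proj₂ (Partners-total σ y))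
                                in mk⇔ f g
        }
      ; graph       = λ σ {x} {y} → mk⇔
          (λ e → bwd (defines σ x y) (Partners-resp σ A.≈-refl e (proj₂ (Partners-total σ x))))
          (λ r → Partners-functional σ (proj₂ (Partners-total σ x)) (fwd (defines σ x y) r))
      }
      where
      partners : ∀ σ → Def (ε ▸ (q ∙ σ) ▸ (p ∙ σ)) (λ ((_ , y) , x) → Partners σ x y)
      partners σ = Partners-def σ t₀ t₁

      defines : ∀ σ x y → _ ⟷ Partners σ x y
      defines σ x y = Def.holds (partners σ) ((lift tt , y) , x)

  data Outcome : Set ℓ where
    both      : Total → Onto → Outcome
    not-onto  : Total → (y₀ : B.A) → (∀ x → x ~ y₀ → ⊥ {ℓ}) → Outcome
    not-total : Onto → (x₀ : A.A) → (∀ y → x₀ ~ y → ⊥ {ℓ}) → Outcome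

  outcome : Outcome
  outcome with decide Total
  ... | inj₂ h = let x₀ , k = counterexample h
                     ∉dom = λ y r → k (y , r)
                 in not-total (onto-if-not-total x₀ ∉dom) x₀ ∉dom
  ... | inj₁ total with decide Onto
  ...   | inj₁ onto = both total onto
  ...   | inj₂ h    = let y₀ , k = counterexample h in not-onto total y₀ (λ x r → k (x , r))

  -- If y₀ is outside the range of ~, then the objects of 𝒜 of both sorts
  -- inject into the sets of ℬ: the partner of a set does not contain y₀,
  -- whereas a class X goes to the set that consists of y₀ and of the partners
  -- of the elements of X.  Hence each definable collection of objects of 𝒜
  -- is coded by a class of ℬ.
  module Coding (total : Total) (y₀ : B.A) (∉ran : ∀ x → x ~ y₀ → ⊥ {ℓ}) where

    Represents : B.A → A.K → Set ℓ
    Represents z X = y₀ B.∊ z × (∀ x y → x ~ y → y B.∊ z ⟷ x ∊ X)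

    Represents-def : ∀ {E} (v : Term E (q ∙ set)) (w : Term E (p ∙ cls)) →
                     Def E (λ e → Represents (val v e) (val w e))
    Represents-def v w = memᵈ (const y₀) v ∧ᵈ
      ∀ᵈ p set (∀ᵈ q set (~-def t₁ t₀ ⇒ᵈ (memᵈ t₀ (pop (pop v)) ⟺ᵈ memᵈ t₁ (pop (pop w)))))

    Codes : ∀ σ → A.Elem σ → B.K → Set ℓ
    Codes set x D = Σ[ y ∈ B.A ] x ~ y × y B.∊ D
    Codes cls X D = Σ[ z ∈ B.A ] Represents z X × z B.∊ D

    Codes-def : ∀ σ {E} (v : Term E (p ∙ σ)) (w : Term E (q ∙ cls)) →
                Def E (λ e → Codes σ (val v e) (val w e))
    Codes-def set v w = ∃ᵈ q set (~-def (pop v) t₀ ∧ᵈ memᵈ t₀ (pop w))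
    Codes-def cls v w = ∃ᵈ q set (Represents-def t₀ (pop v) ∧ᵈ memᵈ t₀ (pop w))

    Codes-resp : ∀ σ {x D D′} → B._≈_ {cls} D D′ → Codes σ x D → Codes σ x D′
    Codes-resp set e (y , r , m) = y , r , B.∊-respʳ e m
    Codes-resp cls e (z , r , m) = z , r , B.∊-respʳ e m

    Codes-respˡ : ∀ σ {x x′ D} → A._≈_ {σ} x x′ → Codes σ x D → Codes σ x′ D
    Codes-respˡ set e (y , r , m)       = y , ~-resp e B.≈-refl r , m
    Codes-respˡ cls e (z , (n , h) , m) =
      z , (n , λ x y r → ⟷-trans (h x y r) (A.≈⇒same e x)) , m

    opaque
      representative : ∀ X → Σ[ z ∈ B.A ] Represents z X
      representative X = z , bwd (hz y₀) (bwd (hH y₀) (inj₁ B.≈-refl)) , λ x y r →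
        (λ y∊z → [ (λ e → ⊥-elim (∉ran x (~-resp A.≈-refl e r)))
                 , (λ (x′ , x′∊X , r′) → A.∊-respˡ (injective r′ r) x′∊X)
                 ]′ (fwd (hH y) (fwd (hz y) y∊z))) ,
        (λ x∊X → bwd (hz y) (bwd (hH y) (inj₂ (x , x∊X , r))))
        where
        class : Σ[ H ∈ B.K ] (∀ w → w B.∊ H ⟷ (B._≈_ {set} w y₀ ⊎ (Σ[ x ∈ A.A ] x ∊ X × x ~ w)))
        class = fullB
          (eqᵈ t₀ (const y₀) ∨ᵈ ∃ᵈ p set (memᵈ t₀ (const X) ∧ᵈ ~-def t₀ t₁))
          (λ e → Sum.map (B.≈-trans (B.≈-sym e)) (λ (x , m , r) → x , m , ~-resp A.≈-refl e r))

        H : B.K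
        H = proj₁ class

        hH : ∀ w → w B.∊ H ⟷ (B._≈_ {set} w y₀ ⊎ (Σ[ x ∈ A.A ] x ∊ X × x ~ w))
        hH = proj₂ class

        -- The bound is the successor of `y₀`: partners lie below members of `y₀`, and the extra
        -- member takes care of `y₀` itself.
        next : Σ[ m ∈ B.A ] B.IsSuc m y₀
        next = B.successor y₀

        bounded-H : Σ[ z ∈ B.A ] B.SameMembers z H
        bounded-H = B.bounded H (proj₁ next) λ w w∊H →
          [ (λ e → w , bwd (proj₂ next w) (inj₂ e) , B.≼-refl w)
          , (λ (x , _ , r) → let v , v∊y₀ , l = bounded-range y₀ ∉ran r
                             in v , bwd (proj₂ next v) (inj₁ v∊y₀) , l)
          ]′ (fwd (hH w) w∊H)

        z : B.A
        z = proj₁ bounded-H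

        hz : B.SameMembers z H
        hz = proj₂ bounded-H

    represented-unique : ∀ {X X′ z} → Represents z X → Represents z X′ → A._≈_ {cls} X X′
    represented-unique {X} {X′} (_ , h) (_ , h′) = A.extensional λ x →
      let y , r = total x in ⟷-trans (⟷-sym (h x y r)) (h′ x y r)

    -- The marker `y₀` separates the two sorts: as a member of a partner it would have a preimage
    -- itself. So one class can code sets and classes together.
    partner-not-representative : ∀ {x z X} → x ~ z → Represents z X → ⊥ {ℓ}
    partner-not-representative r (y₀∊z , _) =
      let u , _ , s = back r y₀ y₀∊z in ∉ran u s

    opaque
      codes : (P : ∀ σ → A.Elem σ → Set ℓ) →
              (∀ σ → Def (ε ▸ (p ∙ σ)) (λ e → P σ (proj₂ e))) →
              (∀ σ {x y} → A._≈_ {σ} x y → P σ x → P σ y) →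
              Σ[ D ∈ B.K ] (∀ σ x → P σ x ⟷ Codes σ x D)
      codes P P-def P-resp = D , λ { set x → onSets x ; cls X → onClasses X }
        where
        Coded : B.A → Set ℓ
        Coded z = (Σ[ x ∈ A.A ] x ~ z × P set x) ⊎ (Σ[ X ∈ A.K ] Represents z X × P cls X)

        class : Σ[ D ∈ B.K ] (∀ z → z B.∊ D ⟷ Coded z)
        class = fullB
          (∃ᵈ p set (~-def t₀ t₁ ∧ᵈ substᵈ (P-def set) (∅ ▹ t₀))
           ∨ᵈ ∃ᵈ p cls (Represents-def t₁ t₀ ∧ᵈ substᵈ (P-def cls) (∅ ▹ t₀)))
          (λ e → Sum.map
            (λ (x , r , c) → x , ~-resp A.≈-refl e r , c)
            (λ (X , (m , h) , c) → X , (B.∊-respʳ e m , λ x y r →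
               ⟷-trans (⟷-sym (B.≈⇒same e y)) (h x y r)) , c))

        D : B.K
        D = proj₁ class

        hD : ∀ z → z B.∊ D ⟷ Coded z
        hD = proj₂ class

        onSets : ∀ x → P set x ⟷ Codes set x D
        onSets x =
          (λ c → let y , r = total x in y , r , bwd (hD y) (inj₁ (x , r , c))) ,
          (λ (y , r , m) →
            [ (λ (x′ , r′ , c) → P-resp set (injective r′ r) c)
            , (λ (X , rep , _) → ⊥-elim (partner-not-representative r rep))
            ]′ (fwd (hD y) m))

        onClasses : ∀ X → P cls X ⟷ Codes cls X D
        onClasses X =
          (λ c → let z , rep = representative X in z , rep , bwd (hD z) (inj₂ (X , rep , c))) ,
          (λ (z , rep , m) →
            [ (λ (x , r , _) → ⊥-elim (partner-not-representative r rep))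
            , (λ (X′ , rep′ , c) → P-resp cls (represented-unique rep′ rep) c)
            ]′ (fwd (hD z) m))

-- Fullness by comprehension, and representatives of interpreted sets

identity-full : {𝒯 : Structure ℓ} → ExcludedMiddle ℓ → 𝒯 ⊨ KM → Full (identity {𝒮 = 𝒯})
identity-full {𝒯 = 𝒯} em km d _ =
  let X , h = ClassTheory.comprehend em 𝒯 km (Definable.formula (Def.defn d (tt , tt)))
                                            (Definable.params (Def.defn d (tt , tt)))
  in X , λ x → ⟷-trans (h x) (Def.holds d (lift tt , x))

-- `Eq` ignores the domain proofs and is given by a formula, which respects the equality of 𝒯;
-- reflexivity then gives the claim.
representation-cong : {𝒯 : Structure ℓ} (J : Interpretation 𝒯) (σ s : Sort) {x x′ : Elem 𝒯 s}
                      (h : InDomain J σ s x) (h′ : InDomain J σ s x′) → Structure._≈_ 𝒯 {s} x x′ →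
                      Interpretation.Eq J σ (s , x , h) (s , x′ , h′)
representation-cong {𝒯 = 𝒯} J σ s {x} {x′} h h′ e =
  ⊨-resp (Definable.formula d) {x ∷ x ∷ Definable.params d} {x ∷ x′ ∷ Definable.params d}
    (≈-refl ∷≋ e ∷≋ ≋-refl {ρ = Definable.params d})
    (IsEquivalence.refl (Interpretation.Eq-isEquivalence J σ) {s , x , h})
  where
  open Equality 𝒯

  d : Definable 𝒯 (s ∷ s ∷ [])
  d = Interpretation.equality J σ s s

-- Rep s a y means that the object a of sort s represents the set y of ℳ.
record Representation {𝒯 ℳ : Structure ℓ} (q : 𝒯 ⊵ ℳ) : Set (suc ℓ) where
  private
    module T = Structure 𝒯
    module M = Structure ℳ
  field
    Rep        : ∀ s → T.Elem s → M.Elem set → Set ℓ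
    Rep-def    : ∀ s {E} (v : Term E (identity ∙ s)) (w : Term E (q ∙ set)) →
                 Def E (λ e → Rep s (val v e) (val w e))
    Rep-resp   : ∀ s {a a′ y y′} → T._≈_ {s} a a′ → M._≈_ {set} y y′ → Rep s a y → Rep s a′ y′
    Rep-unique : ∀ s {a y y′} → Rep s a y → Rep s a y′ → M._≈_ {set} y y′
    represent  : ∀ y → Σ[ s ∈ Sort ] Σ[ a ∈ T.Elem s ] Rep s a y

representation : {𝒯 : Structure ℓ} (J : Interpretation 𝒯) → Representation (identity then J)
representation {ℓ} {𝒯} J = record
  { Rep        = Rep
  ; Rep-def    = λ s v w → substᵈ
      (untag {E = ε ▸ ((identity then J) ∙ set)}
             {P = λ ((_ , y) , z) → _≈_ {set} y z} (eqᵈ t₁ t₀) s)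
      (∅ ▹ w ▹ v)
  ; Rep-resp   = λ { s {a} {a′} {y} {y′} e f (h , g) →
      domain-resp s e h , ≈-trans {i = y′} {y} {s , a′ , domain-resp s e h} (≈-sym {x = y} {y′} f)
        (≈-trans {i = y} {s , a , h} {s , a′ , domain-resp s e h} g
          (representation-cong J set s h (domain-resp s e h) e)) }
  ; Rep-unique = λ { s {a} {y} {y′} (h , g) (h′ , g′) →
      ≈-trans {i = y} {s , a , h} {y′} g
        (≈-trans {i = s , a , h} {s , a , h′} {y′}
          (representation-cong J set s h h′ T.≈-refl)
          (≈-sym {x = y′} {s , a , h′} g′)) }
  ; represent  = λ { (s , a , h) → s , a , h , ≈-refl {x = s , a , h} }
  }
  where
  module T = Equality 𝒯
  open Structure ⟦ J ⟧ using (_≈_)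
  open module Eq {s} = IsEquivalence (Interpretation.Eq-isEquivalence J s)
    renaming (refl to ≈-refl; sym to ≈-sym; trans to ≈-trans)

  Rep : ∀ s → Elem 𝒯 s → Elem ⟦ J ⟧ set → Set ℓ
  Rep s a y = Σ[ h ∈ InDomain J set s a ] _≈_ {set} y (s , a , h)

  domain-resp : ∀ s {a a′} → T._≈_ {s} a a′ → InDomain J set s a → InDomain J set s a′
  domain-resp s {a} {a′} e =
    T.⊨-resp (Definable.formula d) {a ∷ Definable.params d} {a′ ∷ Definable.params d}
             (e T.∷≋ T.≋-refl {ρ = Definable.params d})
    where
    d : Definable 𝒯 (s ∷ [])
    d = Interpretation.domain J set s

-- Bisimilarity coded by classes

module CodedBisimulations
  (em : ExcludedMiddle ℓ) {𝒯 ℳ : Structure ℓ} (km : 𝒯 ⊨ KM) (cc : 𝒯 ⊨ CCset) (kmM : ℳ ⊨ KM)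
  {q : 𝒯 ⊵ ℳ} (R : Representation q) where

  open Representation R

  private
    p : 𝒯 ⊵ 𝒯
    p = identity

    module M where
      open ClassTheory em ℳ kmM public
      open Equality ℳ public

  open ClassTheory em 𝒯 km
  open Equality 𝒯 hiding (Elem; universe; mem)

  opaque
    choose : (Φ : A → K → Set ℓ) →
             Def (ε ▸ (p ∙ set) ▸ (p ∙ cls)) (λ ((_ , x) , X) → Φ x X) →
             (s : A) → (∀ x → x ∊ s → Σ[ X ∈ K ] Φ x X) →
             Σ[ Y ∈ K ] (∀ x → x ∊ s → Σ[ X ∈ K ] (∀ u → u ∊ X ⟷ ⟨ x , u ⟩∊ Y) × Φ x X)
    choose Φ d s h =
      let Y , k = universalClosure-elim 𝒯 _ (cc _ (classChoice-ax φ′)) (s ∷ π)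
                    (λ x m → let X , c = h x m in X , bwd (holds x X) c)
      in Y , λ x m → let X , section , c = k x m
                     in X , section , fwd (holds x X) (fwd (shift x X Y) c)
      where
      D : Definable 𝒯 (cls ∷ set ∷ [])
      D = Def.defn d ((tt , tt) , tt)

      π : Env 𝒯 (Definable.Δ D)
      π = Definable.params D

      -- `r` makes room for the index set `s`, which `classChoice` places before the parameters;
      -- `r′` is the renaming by which `classChoice` makes room for `Y`.
      r : (cls ∷ set ∷ Definable.Δ D) ⊆ (cls ∷ set ∷ set ∷ Definable.Δ D)
      r = lift⊆ (lift⊆ there)

      φ′ : Formula (cls ∷ set ∷ set ∷ Definable.Δ D)
      φ′ = rename r (Definable.formula D)

      holds : ∀ x X → 𝒯 ⊨ φ′ [ X ∷ x ∷ s ∷ π ] ⟷ Φ x X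
      holds x X = ⟷-trans
        (rename-⊨ 𝒯 r (Definable.formula D) λ { v0 → refl ; v1 → refl ; (there (there i)) → refl })
        (Def.holds d ((lift tt , x) , X))

      r′ : (cls ∷ set ∷ set ∷ Definable.Δ D) ⊆ (cls ∷ set ∷ cls ∷ set ∷ Definable.Δ D)
      r′ = lift⊆ (lift⊆ there)

      shift : (x : A) (X Y : K) →
              𝒯 ⊨ rename r′ φ′ [ X ∷ x ∷ Y ∷ s ∷ π ] ⟷ 𝒯 ⊨ φ′ [ X ∷ x ∷ s ∷ π ]
      shift x X Y =
        rename-⊨ 𝒯 r′ φ′ {X ∷ x ∷ s ∷ π} {X ∷ x ∷ Y ∷ s ∷ π}
          λ { v0 → refl ; v1 → refl ; (there (there i)) → refl }

  -- Three classes Y₁, Y₂, W code a relation between the sets of 𝒯 and those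
  -- of ℳ.  Partners of x that are represented by sets a are given by the pairs
  -- ⟨x, a⟩ in Y₁; if x lies in W, then there is also the partner that is
  -- represented by the class (Y₂)ₓ.

  IsSection : K → K → A → Set ℓ
  IsSection X Y x = ∀ u → u ∊ X ⟷ ⟨ x , u ⟩∊ Y

  Related : K → K → K → A → M.A → Set ℓ
  Related Y₁ Y₂ W x y = (Σ[ a ∈ A ] Rep set a y × ⟨ x , a ⟩∊ Y₁)
                      ⊎ (Σ[ X ∈ K ] Rep cls X y × x ∊ W × IsSection X Y₂ x)

  Related-resp : ∀ {Y₁ Y₂ W x x′ y y′} → x ≈ x′ → M._≈_ {set} y y′ →
                 Related Y₁ Y₂ W x y → Related Y₁ Y₂ W x′ y′
  Related-resp e f = Sum.map
    (λ (a , ρ , l) → a , Rep-resp set ≈-refl f ρ , ⟨,⟩∊-resp e ≈-refl l)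
    (λ (X , ρ , m , h) → X , Rep-resp cls ≈-refl f ρ , ∊-respˡ e m , λ u →
      ⟷-trans (h u) (⟨,⟩∊-resp e ≈-refl , ⟨,⟩∊-resp (≈-sym e) ≈-refl))

  pair-def : ∀ {E} (x y : Term E (p ∙ set)) (Y : Term E (p ∙ cls)) →
             Def E (λ e → ⟨ val x e , val y e ⟩∊ val Y e)
  pair-def x y Y = formulaᵈ (⟨ v0 , v1 ⟩ϵ v2) (x ∷ y ∷ Y ∷ [])

  Related-def : ∀ {E} (Y₁ Y₂ W : Term E (p ∙ cls)) (x : Term E (p ∙ set)) (y : Term E (q ∙ set)) →
                Def E (λ e → Related (val Y₁ e) (val Y₂ e) (val W e) (val x e) (val y e))
  Related-def Y₁ Y₂ W x y =
    ∃ᵈ p set (Rep-def set t₀ (pop y) ∧ᵈ pair-def (pop x) t₀ (pop Y₁))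
    ∨ᵈ ∃ᵈ p cls (Rep-def cls t₀ (pop y) ∧ᵈ memᵈ (pop x) (pop W) ∧ᵈ
         ∀ᵈ p set (memᵈ t₀ t₁ ⟺ᵈ pair-def (pop (pop x)) t₀ (pop (pop Y₂))))

  BackAndForth : K → K → K → Set ℓ
  BackAndForth Y₁ Y₂ W = ∀ x y → Related Y₁ Y₂ W x y →
      (∀ u → u ∊ x → Σ[ z ∈ M.A ] z M.∊ y × Related Y₁ Y₂ W u z)
    × (∀ z → z M.∊ y → Σ[ u ∈ A ] u ∊ x × Related Y₁ Y₂ W u z)

  infix 4 _≃_
  _≃_ : A → M.A → Set ℓ
  x ≃ y = Σ[ Y₁ ∈ K ] Σ[ Y₂ ∈ K ] Σ[ W ∈ K ] BackAndForth Y₁ Y₂ W × Related Y₁ Y₂ W x y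

  BackAndForth-def : ∀ {E} (Y₁ Y₂ W : Term E (p ∙ cls)) →
                     Def E (λ e → BackAndForth (val Y₁ e) (val Y₂ e) (val W e))
  BackAndForth-def {E} Y₁ Y₂ W =
    ∀ᵈ p set (∀ᵈ q set (Related-def (pop (pop Y₁)) (pop (pop Y₂)) (pop (pop W)) t₁ t₀ ⇒ᵈ
      (∀ᵈ p set (memᵈ t₀ t₂ ⇒ᵈ ∃ᵈ q set (memᵈ t₀ t₂ ∧ᵈ related t₁ t₀)))
      ∧ᵈ ∀ᵈ q set (memᵈ t₀ t₁ ⇒ᵈ ∃ᵈ p set (memᵈ t₀ (pop t₂) ∧ᵈ related t₀ t₁))))
    where
    related : ∀ {k k′ k″ k‴} (x : Term (E ▸ k ▸ k′ ▸ k″ ▸ k‴) (p ∙ set))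
              (y : Term (E ▸ k ▸ k′ ▸ k″ ▸ k‴) (q ∙ set)) → Def (E ▸ k ▸ k′ ▸ k″ ▸ k‴) _
    related = Related-def (pop (pop (pop (pop Y₁)))) (pop (pop (pop (pop Y₂))))
                          (pop (pop (pop (pop W))))

  bisimilarity : Bisimulation p q
  bisimilarity = record
    { _~_    = _≃_
    ; ~-def  = λ v w → ∃ᵈ p cls (∃ᵈ p cls (∃ᵈ p cls
        (BackAndForth-def t₂ t₁ t₀
         ∧ᵈ Related-def t₂ t₁ t₀ (pop (pop (pop v))) (pop (pop (pop w))))))
    ; ~-resp = λ { e f (Y₁ , Y₂ , W , h , r) → Y₁ , Y₂ , W , h , Related-resp e f r }
    ; forth  = λ { {x} {y} (Y₁ , Y₂ , W , h , r) u m →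
        let z , m′ , r′ = proj₁ (h x y r) u m in z , m′ , Y₁ , Y₂ , W , h , r′ }
    ; back   = λ { {x} {y} (Y₁ , Y₂ , W , h , r) z m →
        let u , m′ , r′ = proj₂ (h x y r) z m in u , m′ , Y₁ , Y₂ , W , h , r′ }
    }

  open Bisimulation bisimilarity using (Matching; Maximal; forth; back; ~-def; ~-resp)

  Matching-def : ∀ {E} (x : Term E (p ∙ set)) (y : Term E (q ∙ set)) →
                 Def E (λ e → Matching (val x e) (val y e))
  Matching-def x y =
    ∀ᵈ p set (memᵈ t₀ (pop x) ⇒ᵈ ∃ᵈ q set (memᵈ t₀ (pop (pop y)) ∧ᵈ ~-def t₁ t₀))
    ∧ᵈ ∀ᵈ q set (memᵈ t₀ (pop y) ⇒ᵈ ∃ᵈ p set (memᵈ t₀ (pop (pop x)) ∧ᵈ ~-def t₀ t₁))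

  Matching-resp : ∀ {x x′ y y′} → x ≈ x′ → M._≈_ {set} y y′ → Matching x y → Matching x′ y′
  Matching-resp e f (g , h) =
    (λ u m → let z , n , r = g u (∊-respʳ (≈-sym e) m) in z , M.∊-respʳ f n , r) ,
    (λ z m → let u , n , r = h z (M.∊-respʳ (M.≈-sym f) m) in u , ∊-respʳ e n , r)

  -- With this, a class picked by choice is recognised as representing the intended partner.
  Matching-functional : ∀ {x y y′} → Matching x y → Matching x y′ → M._≈_ {set} y y′
  Matching-functional {x} h h′ = M.extensional λ z → included h h′ z , included h′ h z
    where
    included : ∀ {y y′} → Matching x y → Matching x y′ → ∀ z → z M.∊ y → z M.∊ y′
    included (_ , g) (f , _) z m =
      let u , m′ , r = g z m
          z′ , n , r′ = f u m′
      in M.∊-respˡ (BisimulationProperties.functional em km kmM (identity-full em km)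
                      bisimilarity r′ r) n

  matching : ∀ {x y} → x ≃ y → Matching x y
  matching r = forth r , back r

  -- If x and y match, then the relation "v and z match", restricted to v in
  -- a transitive set t ∋ x, is back-and-forth.  It is coded by choosing, for
  -- each v in t, a class that represents the partner of v.
  module Gluing (t : A) (transitive : IsTransitive t) where

    Partner : ∀ s → A → Elem 𝒯 s → Set ℓ
    Partner s v a = Σ[ z ∈ M.A ] Rep s a z × Matching v z

    partner-def : ∀ s {E} (v : Term E (p ∙ set)) (a : Term E (p ∙ s)) →
                  Def E (λ e → Partner s (val v e) (val a e))
    partner-def s v a = ∃ᵈ q set (Rep-def s (pop a) t₀ ∧ᵈ Matching-def (pop v) t₀)

    opaque
      -- Representatives that are sets can all be collected at once. Those that are classes cannot
      -- be members of a class, and `chosen` picks one for each `v`.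
      setPartners : Σ[ Y ∈ K ] (∀ v a → ⟨ v , a ⟩∊ Y ⟷ (v ∊ t × Partner set v a))
      setPartners =
        let Y , h = identity-full em km
              (∃ᵈ p set (∃ᵈ p set (formulaᵈ (isOrderedPair v0 v1 v2) (t₂ ∷ t₁ ∷ t₀ ∷ [])
                 ∧ᵈ (memᵈ t₁ (const t) ∧ᵈ partner-def set t₁ t₀))))
              (λ e (x , y , op , r) → x , y , orderedPair-resp e ≈-refl ≈-refl op , r)
        in Y , code (λ v a → v ∊ t × Partner set v a) Y
             (λ e f (m , z , ρ , r) →
               ∊-respˡ e m , z , Rep-resp set f M.≈-refl ρ , Matching-resp e M.≈-refl r)
             h

    opaque
      classPartnered : Σ[ W ∈ K ] (∀ v → v ∊ W ⟷ (v ∊ t × (Σ[ X ∈ K ] Partner cls v X)))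
      classPartnered = identity-full em km
        (memᵈ t₀ (const t) ∧ᵈ ∃ᵈ p cls (partner-def cls t₁ t₀))
        (λ e (m , X , z , ρ , r) → ∊-respˡ e m , X , z , ρ , Matching-resp e M.≈-refl r)

    Y₁ W : K
    Y₁ = proj₁ setPartners
    W  = proj₁ classPartnered

    opaque
      -- Class choice ranges over a set of indices. `W` is included in `t`, so it has the same
      -- members as the set `s`.
      chosen : Σ[ Y ∈ K ] (∀ v → v ∊ W → Σ[ X ∈ K ] IsSection X Y v × Partner cls v X)
      chosen =
        let s , hs = separate W t
            Y , h = choose (Partner cls) (partner-def cls t₁ t₀) s λ v v∊s →
              proj₂ (fwd (proj₂ classPartnered v) (proj₂ (fwd (hs v) v∊s)))
        in Y , λ v v∊W →
             h v (bwd (hs v) (proj₁ (fwd (proj₂ classPartnered v) v∊W) , v∊W))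

    Y₂ : K
    Y₂ = proj₁ chosen

    related : ∀ {v z} → v ∊ t → Matching v z → Related Y₁ Y₂ W v z
    related {v} {z} v∊t r with represent z
    ... | set , a , ρ = inj₁ (a , ρ , bwd (proj₂ setPartners v a) (v∊t , z , ρ , r))
    ... | cls , X , ρ =
      let v∊W = bwd (proj₂ classPartnered v) (v∊t , X , z , ρ , r)
          -- The chosen class represents some `z′` that matches `v`, hence `z` itself.
          X′ , section , z′ , ρ′ , r′ = proj₂ chosen v v∊W
      in inj₂ (X′ , Rep-resp cls ≈-refl (Matching-functional r′ r) ρ′ , v∊W , section)

    linked : ∀ {v z} → Related Y₁ Y₂ W v z → v ∊ t × Matching v z
    linked {v} (inj₁ (a , ρ , l)) =
      let v∊t , z′ , ρ′ , r = fwd (proj₂ setPartners v a) l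
      in v∊t , Matching-resp ≈-refl (Rep-unique set ρ′ ρ) r
    linked {v} (inj₂ (X , ρ , v∊W , section)) =
      let X′ , section′ , z′ , ρ′ , r = proj₂ chosen v v∊W
          X′≈X = extensional λ u → ⟷-trans (section′ u) (⟷-sym (section u))
      in proj₁ (fwd (proj₂ classPartnered v) v∊W) ,
         Matching-resp ≈-refl (Rep-unique cls (Rep-resp cls X′≈X M.≈-refl ρ′) ρ) r

    -- The corresponding members of matching sets are bisimilar, so they match in turn, and
    -- transitivity keeps them in `t`.
    backAndForth : BackAndForth Y₁ Y₂ W
    backAndForth v z r =
      let v∊t , f , g = linked r
      in (λ u u∊v → let w , w∊z , s = f u u∊v
                    in w , w∊z , related (transitive u v v∊t u∊v) (matching s)) ,
         (λ w w∊z → let u , u∊v , s = g w w∊z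
                    in u , u∊v , related (transitive u v v∊t u∊v) (matching s))

  bisimilarity-maximal : Maximal
  bisimilarity-maximal {x} {y} r =
    let t , transitive , x∊t = Stages.transitiveSet x
        open Gluing t transitive
    in Y₁ , Y₂ , W , backAndForth , related x∊t r

-- Invariance of definable properties and their translation along a chain

Holds-resp : {𝒮 : Structure ℓ} {σ : Sort} (d : Definable 𝒮 (σ ∷ [])) →
             ∀ {x y} → Structure._≈_ 𝒮 {σ} x y →
             Definable.Holds d (x ∷ []) → Definable.Holds d (y ∷ [])
Holds-resp {𝒮 = 𝒮} d {x} {y} e =
  ⊨-resp (Definable.formula d) {x ∷ Definable.params d} {y ∷ Definable.params d}
    (e ∷≋ ≋-refl {ρ = Definable.params d})
  where open Equality 𝒮

Def-resp : {𝒮 : Structure ℓ} {σ : Sort} {P : Elem 𝒮 σ → Set ℓ} →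
           Def (ε ▸ (identity {𝒮 = 𝒮} ∙ σ)) (λ e → P (proj₂ e)) →
           ∀ {x y} → Structure._≈_ 𝒮 {σ} x y → P x → P y
Def-resp d {x} {y} e r = fwd (Def.holds d (lift tt , y))
  (Holds-resp (Def.defn d (tt , tt)) e (bwd (Def.holds d (lift tt , x)) r))

module _ {𝒮 𝒯 : Structure ℓ} (p : 𝒮 ⊵ 𝒯) (J : Interpretation 𝒯) where

  -- A tag for `p then J` is a sort `s` of 𝒯 with a tag for `p`. The formula over 𝒯 that belongs to
  -- `s` is translated along `p`.
  liftDef₁ : ∀ {σ} {P : Elem ⟦ J ⟧ σ → Set ℓ} →
             Def (ε ▸ ((identity then J) ∙ σ)) (λ e → P (proj₂ e)) →
             Def (ε ▸ ((p then J) ∙ σ)) (λ e → P (proj₂ e))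
  liftDef₁ d = record
    { defn  = λ { (_ , (s , u)) → Def.defn (translated s) (tt , u) }
    ; holds = λ { (e , (s , x , h)) →
        ⟷-trans (Def.holds (translated s) (e , x)) (Def.holds d (lift tt , (s , x , h))) }
    }
    where
    translated : ∀ s → Def (ε ▸ (p ∙ s)) _
    translated s = holdsᵈ (Def.defn d (tt , (s , tt))) (t₀ ∷ [])

  liftDef₂ : ∀ {σ τ} {P : Elem ⟦ J ⟧ σ → Elem 𝒯 τ → Set ℓ} →
             Def (ε ▸ ((identity then J) ∙ σ) ▸ (identity ∙ τ)) (λ ((_ , x) , y) → P x y) →
             Def (ε ▸ ((p then J) ∙ σ) ▸ (p ∙ τ)) (λ ((_ , x) , y) → P x y)
  liftDef₂ {τ = τ} d = record
    { defn  = λ { ((_ , (s , u)) , w) → Def.defn (translated s) ((tt , u) , w) }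
    ; holds = λ { ((e , (s , x , h)) , y) →
        ⟷-trans (Def.holds (translated s) ((e , x) , y))
                (Def.holds d ((lift tt , (s , x , h)) , y)) }
    }
    where
    translated : ∀ s → Def (ε ▸ (p ∙ s) ▸ (p ∙ τ)) _
    translated s = holdsᵈ (Def.defn d ((tt , (s , tt)) , tt)) (t₀ ∷ t₁ ∷ [])

-- Self-interpretations

module SelfInterpretation {𝒮 ℳ : Structure ℓ} {p : 𝒮 ⊵ ℳ}
                          (i : DefinableIsomorphism (identity {𝒮 = 𝒮}) p) where

  open DefinableIsomorphism i using (relation; graph; isomorphism)
  open Isomorphism isomorphism using (bijection; fun; fun-mem) public
  private
    module S = Equality 𝒮
    module M = Equality ℳ

  correspondence : Correspondence 𝒮 ℳ
  correspondence = record
    { Rel   = λ x y → M._≈_ (fun x) y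
    ; total = λ x → fun x , M.≈-refl
    ; onto  = λ {s} → Bijection.strictlySurjective (bijection s)
    ; equal = λ {s} e f →
        (λ g → M.≈-trans (M.≈-sym e) (M.≈-trans (Bijection.cong (bijection s) g) f)) ,
        (λ g → Bijection.injective (bijection s) (M.≈-trans e (M.≈-trans g (M.≈-sym f))))
    ; memb  = λ {s} {x} {x′} e f →
        (λ m → M.mem-resp e f (Equivalence.to (fun-mem x x′) m)) ,
        (λ m → Equivalence.from (fun-mem x x′) (M.mem-resp (M.≈-sym e) (M.≈-sym f) m))
    }

  graph-def : ∀ σ → Def (ε ▸ (p ∙ σ) ▸ (identity ∙ σ)) (λ ((_ , y) , x) → M._≈_ {σ} (fun x) y)
  graph-def σ = record
    { defn  = λ ((_ , u) , t) → relation σ t u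
    ; holds = λ ((_ , y) , x) →
        Equivalence.from (graph σ {x} {y}) , Equivalence.to (graph σ {x} {y})
    }

  -- The property is pulled back along the isomorphism to 𝒮, where comprehension yields a class; its
  -- image is the required class of ℳ.
  full : ExcludedMiddle ℓ → 𝒮 ⊨ KM → Full p
  full em km {P} d resp =
    let X , hX = identity-full em km
          (∃ᵈ p set (substᵈ (graph-def set) (∅ ▹ t₀ ▹ t₁) ∧ᵈ substᵈ d (∅ ▹ t₀)))
          (λ e (y , f , r) → y , M.≈-trans (Bijection.cong (bijection set) (S.≈-sym e)) f , r)
    in fun X , λ y →
      let x , e = Bijection.strictlySurjective (bijection set) y in
      (λ m → let y′ , f , r = fwd (hX x)
                   (Equivalence.from (fun-mem x X) (M.mem-resp (M.≈-sym e) M.≈-refl m))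
             in resp (M.≈-trans (M.≈-sym f) e) r) ,
      (λ r → M.mem-resp e M.≈-refl (Equivalence.to (fun-mem x X) (bwd (hX x) (y , e , r))))

  -- `fun` is available only through its definable graph, so its value is introduced by an
  -- existential quantifier.
  precompose : ∀ {σ k} {G : Elem ℳ σ → Obj k → Set ℓ} →
               Def (ε ▸ (p ∙ σ) ▸ k) (λ ((_ , y) , z) → G y z) →
               (∀ {y y′ z} → M._≈_ {σ} y y′ → G y z → G y′ z) →
               Def (ε ▸ (identity ∙ σ) ▸ k) (λ ((_ , x) , z) → G (fun x) z)
  precompose {σ} d resp = ⟷-Def
    (∃ᵈ p σ (substᵈ (graph-def σ) (∅ ▹ t₀ ▹ t₂) ∧ᵈ substᵈ d (∅ ▹ t₀ ▹ t₁)))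
    λ ((_ , x) , z) → (λ (y , e , g) → resp (M.≈-sym e) g) , (λ g → fun x , M.≈-refl , g)

  push : ∀ {σ} → Definable 𝒮 (σ ∷ []) → Definable ℳ (σ ∷ [])
  push d = record { formula = Definable.formula d ; params = All.map fun (Definable.params d) }

  push-holds : ∀ {σ} (d : Definable 𝒮 (σ ∷ [])) x →
               Definable.Holds d (x ∷ []) ⟷ Definable.Holds (push d) (fun x ∷ [])
  push-holds d x = transfer (Definable.formula d)
    {x ∷ Definable.params d} {fun x ∷ All.map fun (Definable.params d)}
    (extend {ρ = Definable.params d} {All.map fun (Definable.params d)}
            (mapped (Definable.params d)) M.≈-refl)
    where
    open Correspondence correspondence

    mapped : ∀ {Δ} (π : Env 𝒮 Δ) → RelEnv π (All.map fun π)
    mapped (a ∷ π) (here refl) = M.≈-refl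
    mapped (a ∷ π) (there x)   = mapped π x

  -- The isomorphism turns a property definable over 𝒮 into one definable over ℳ, with parameters
  -- moved along `fun`. Since ℳ is interpreted in 𝒯, that property is 𝒯-definable and can be coded.
  pull-codes : ∀ {𝒯 : Structure ℓ} (q : 𝒯 ⊵ ℳ) {X : Set ℓ} (G : ∀ σ → Elem ℳ σ → X → Set ℓ) →
    ((P : ∀ σ → Elem ℳ σ → Set ℓ) → (∀ σ → Def (ε ▸ (q ∙ σ)) (λ e → P σ (proj₂ e))) →
      (∀ σ {x y} → M._≈_ {σ} x y → P σ x → P σ y) →
      Σ[ D ∈ X ] (∀ σ y → P σ y ⟷ G σ y D)) →
    (P : ∀ σ → Elem 𝒮 σ → Set ℓ) →
    (∀ σ → Def (ε ▸ (identity {𝒮 = 𝒮} ∙ σ)) (λ e → P σ (proj₂ e))) →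
    Σ[ D ∈ X ] (∀ σ x → P σ x ⟷ G σ (fun x) D)
  pull-codes q G codes P P-def =
    let D , coded = codes (λ σ y → Definable.Holds (pushed σ) (y ∷ []))
                      (λ σ → holdsᵈ (pushed σ) (t₀ ∷ []))
                      (λ σ → Holds-resp (pushed σ))
    in D , λ σ x → ⟷-trans (⟷-sym (Def.holds (P-def σ) (lift tt , x)))
         (⟷-trans (push-holds (Def.defn (P-def σ) (tt , tt)) x) (coded σ (fun x)))
    where
    pushed : ∀ σ → Definable ℳ (σ ∷ [])
    pushed σ = push (Def.defn (P-def σ) (tt , tt))

-- Cantor's diagonal argument

Uncodable : {𝒮 ℳ : Structure ℓ} → 𝒮 ⊵ ℳ → Set (suc ℓ)
Uncodable {ℓ} {𝒮} {ℳ} p =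
  (G : ∀ σ → Elem 𝒮 σ → Elem ℳ cls → Set ℓ) →
  (∀ σ → Def (ε ▸ (identity ∙ σ) ▸ (p ∙ cls)) (λ ((_ , x) , D) → G σ x D)) →
  (∀ σ {x D D′} → Structure._≈_ ℳ {cls} D D′ → G σ x D → G σ x D′) →
  ((P : ∀ σ → Elem 𝒮 σ → Set ℓ) →
    (∀ σ → Def (ε ▸ (identity {𝒮 = 𝒮} ∙ σ)) (λ e → P σ (proj₂ e))) →
    Σ[ D ∈ Elem ℳ cls ] (∀ σ x → P σ x ⟷ G σ x D)) →
  ⊥ {ℓ}

-- A class of the interpreted structure is an object of 𝒮 with a domain proof, so it can be tested
-- against the collection that it codes.
cantor : {𝒮 : Structure ℓ} (I : Interpretation 𝒮) → Uncodable (identity then I)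
cantor {ℓ} {𝒮} I G G-def G-resp codes = contradiction (codes Diagonal Diagonal-def)
  where
  Diagonal : ∀ σ → Elem 𝒮 σ → Set ℓ
  Diagonal σ x = Σ[ h ∈ InDomain I cls σ x ] (G σ x (σ , x , h) → ⊥ {ℓ})

  Diagonal-def : ∀ σ → Def (ε ▸ (identity ∙ σ)) (λ e → Diagonal σ (proj₂ e))
  Diagonal-def σ = substᵈ
    (untag {P = λ ((_ , x) , D) → G σ x D → ⊥} (∼ᵈ G-def σ) σ) (∅ ▹ t₀ ▹ t₀)

  contradiction : Σ[ D ∈ Elem ⟦ I ⟧ cls ] (∀ σ x → Diagonal σ x ⟷ G σ x D) → ⊥
  contradiction ((s , d , h) , coded) = outside (bwd (coded s d) inside)
    where
    outside : Diagonal s d → ⊥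
    outside (h′ , ¬g) =
      -- The diagonal brings its own domain proof `h′`; with `h` or `h′`, `d` is the same class up
      -- to `Eq`.
      ¬g (G-resp s {d} {s , d , h} {s , d , h′}
           (representation-cong I cls s h h′ (Equality.≈-refl 𝒮)) (fwd (coded s d) (h′ , ¬g)))

    inside : G s d (s , d , h)
    inside = fwd (coded s d) (h , λ g → outside (bwd (coded s d) g))

-- The three outcomes of the comparison

module Solidity
  (em : ExcludedMiddle ℓ) {𝒮 𝒯 ℳ : Structure ℓ}
  (kmS : 𝒮 ⊨ KM) (kmT : 𝒯 ⊨ KM) (ccT : 𝒯 ⊨ CCset) (kmM : ℳ ⊨ KM)
  {p : 𝒮 ⊵ 𝒯} {q : 𝒯 ⊵ ℳ} {pq : 𝒮 ⊵ ℳ}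
  -- `pq` stands for the composition of `p` and `q`; `lift₁` and `lift₂` express this by turning
  -- definability over 𝒯 into definability over 𝒮.
  (lift₁ : ∀ {σ} {P : Elem ℳ σ → Set ℓ} →
    Def (ε ▸ (q ∙ σ)) (λ e → P (proj₂ e)) → Def (ε ▸ (pq ∙ σ)) (λ e → P (proj₂ e)))
  (lift₂ : ∀ {σ τ} {P : Elem ℳ σ → Elem 𝒯 τ → Set ℓ} →
    Def (ε ▸ (q ∙ σ) ▸ (identity ∙ τ)) (λ ((_ , x) , y) → P x y) →
    Def (ε ▸ (pq ∙ σ) ▸ (p ∙ τ)) (λ ((_ , x) , y) → P x y))
  (R : Representation q) (uncodableT : Uncodable p) (uncodableM : Uncodable q)
  (i : DefinableIsomorphism (identity {𝒮 = 𝒮}) pq) where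

  private
    module Iso = SelfInterpretation i

    fullT : Full (identity {𝒮 = 𝒯})
    fullT = identity-full em kmT

    fullM : Full q
    fullM d resp = Iso.full em kmS (lift₁ d) resp

  open CodedBisimulations em kmT ccT kmM R using (bisimilarity; bisimilarity-maximal)
  open Comparison em kmT kmM fullT fullM bisimilarity bisimilarity-maximal
  private
    module Converse = Comparison em kmM kmT fullM fullT (converse bisimilarity)
                        (λ (f , g) → bisimilarity-maximal (g , f))

  definableIsomorphism : DefinableIsomorphism (identity {𝒮 = 𝒯}) q
  definableIsomorphism with outcome
  ... | both total onto = Totality.definableIsomorphism total onto
  ... | not-onto total y₀ ∉ran = ⊥-elim (uncodableM Codes
    (λ σ → Codes-def σ t₁ t₀) (λ σ {x} → Codes-resp σ {x})
    (λ P P-def → codes P P-def (λ σ → Def-resp (P-def σ))))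
    where open Coding total y₀ ∉ran
  ... | not-total onto x₀ ∉dom = ⊥-elim (uncodableT (λ σ x → Codes σ (Iso.fun x))
    -- The coding of ℳ is definable over 𝒯, hence over 𝒮, and the isomorphism makes it a coding of
    -- the objects of 𝒮.
    (λ σ → Iso.precompose (lift₂ (Codes-def σ t₁ t₀)) (Codes-respˡ σ))
    (λ σ {x} → Codes-resp σ {Iso.fun x}) (Iso.pull-codes q Codes codes))
    where open Converse.Coding onto x₀ ∉dom

theorem2p7 : ∀ {ℓ} → ExcludedMiddle ℓ → Solid ℓ (KM ∪ CCset)
theorem2p7 em 𝒮 I J S⊨ T⊨ M⊨ =
  Solidity.definableIsomorphism em
    (λ φ ax → S⊨ φ (inj₁ ax)) (λ φ ax → T⊨ φ (inj₁ ax)) (λ φ ax → T⊨ φ (inj₂ ax))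
    (λ φ ax → M⊨ φ (inj₁ ax))
    (liftDef₁ (identity then I) J) (liftDef₂ (identity then I) J)
    (representation J) (cantor I) (cantor J)
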